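{- Let $G$ be a graph such that for all $S\subseteq V(G)$ $$\frac{3}{2}\,iso(G\setminus S)+\omega(G\setminus S)\le \frac{1}{2}|S|+1.$$ Then $G$ has a connected $\{2,4\}$-factor.
   Context: Graphs are finite, have no loops, but may have multiple edges; degrees count multiplicities. For $S\subseteq V(G)$, $G\setminus S$ is the graph obtained by deleting $S$; $\omega(\cdot)$ is the number of connected components and $iso(\cdot)$ the number of isolated vertices. For a set $A$ of integers, an $A$-factor is a spanning subgraph all of whose vertex degrees lie in $A$. -}

module Defs where

open import Data.Nat.Base using (ℕ; _≤_; _<_)
open import Data.Nat.Properties using (_≟_; _<?_; +-0-commutativeMonoid)
open import Data.Integer.Base as ℤ using (ℤ; +_)
open import Data.Rational.Base using (ℚ; _/_)
open import Data.Fin.Base using (Fin; zero; suc)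
import Data.Fin.Properties as Fin
open import Data.Fin.Subset using (Subset; inside; outside; ∣_∣; ∁)
open import Data.Vec.Base using ([]; _∷_)
open import Data.List.Base using (List; []; _∷_; length; filter; deduplicate; allFin)
open import Data.List.Membership.Propositional using (_∈_)
open import Data.List.Membership.Propositional.Properties using (∈-allFin)
open import Data.List.Relation.Unary.Any using (here; there)
open import Data.Product.Base using (_×_; _,_)
open import Data.Sum.Base using (_⊎_; inj₁; inj₂; [_,_]′)
open import Level using (0ℓ)
open import Relation.Binary.Core using (Rel)
open import Relation.Binary.Definitions using (Decidable)
open import Relation.Binary.Construct.Closure.ReflexiveTransitive using (Star; ε; _◅_; _◅◅_)
open import Relation.Binary.PropositionalEquality using (_≡_; refl)
open import Relation.Nullary.Decidable using (_×-dec_; _⊎-dec_; map′)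
open import Relation.Unary using (Pred)
open import Algebra.Properties.CommutativeMonoid.Sum +-0-commutativeMonoid using (sum)

-- Loopless multigraphs on the vertex set Fin n, given by the number of
-- parallel edges between each pair of vertices.
record Multigraph (n : ℕ) : Set where
  field
    mult     : Fin n → Fin n → ℕ
    mult-sym : ∀ u v → mult u v ≡ mult v u
    loopless : ∀ v → mult v v ≡ 0

open Multigraph public

deg : ∀ {n} → Multigraph n → Fin n → ℕ
deg G v = sum (mult G v)

Adj : ∀ {n} → Multigraph n → Rel (Fin n) 0ℓ
Adj G u v = 0 < mult G u v

Reachable : ∀ {n} → Multigraph n → Rel (Fin n) 0ℓ
Reachable G = Star (Adj G)

Connected : ∀ {n} → Multigraph n → Set
Connected G = ∀ u v → Reachable G u v

-- Reachability in a finite relation is decidable (Floyd–Warshall):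
-- Via ws u v says that v can be reached from u with all intermediate
-- vertices among ws.
module _ {n} {_~_ : Rel (Fin n) 0ℓ} (_~?_ : Decidable _~_) where

  private
    Via : List (Fin n) → Rel (Fin n) 0ℓ
    Via []       u v = u ≡ v ⊎ u ~ v
    Via (w ∷ ws) u v = Via ws u v ⊎ (Via ws u w × Via ws w v)

    via? : ∀ ws → Decidable (Via ws)
    via? []       u v = (u Fin.≟ v) ⊎-dec (u ~? v)
    via? (w ∷ ws) u v = via? ws u v ⊎-dec (via? ws u w ×-dec via? ws w v)

    sound : ∀ ws {u v} → Via ws u v → Star _~_ u v
    sound []       (inj₁ refl)    = ε
    sound []       (inj₂ e)       = e ◅ ε
    sound (w ∷ ws) (inj₁ p)       = sound ws p
    sound (w ∷ ws) (inj₂ (p , q)) = sound ws p ◅◅ sound ws q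

    via-refl : ∀ ws {u} → Via ws u u
    via-refl []       = inj₁ refl
    via-refl (w ∷ ws) = inj₁ (via-refl ws)

    via-edge : ∀ ws {u v} → u ~ v → Via ws u v
    via-edge []       e = inj₂ e
    via-edge (w ∷ ws) e = inj₁ (via-edge ws e)

    via-trans : ∀ {ws u x v} → x ∈ ws → Via ws u x → Via ws x v → Via ws u v
    via-trans (here refl) p q =
      inj₂ ([ (λ a → a) , (λ (a , _) → a) ]′ p , [ (λ b → b) , (λ (_ , b) → b) ]′ q)
    via-trans (there x∈) (inj₁ p)       (inj₁ q)       = inj₁ (via-trans x∈ p q)
    via-trans (there x∈) (inj₁ p)       (inj₂ (q , r)) = inj₂ (via-trans x∈ p q , r)
    via-trans (there x∈) (inj₂ (p , q)) (inj₁ r)       = inj₂ (p , via-trans x∈ q r)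
    via-trans (there x∈) (inj₂ (p , _)) (inj₂ (_ , r)) = inj₂ (p , r)

    complete : ∀ {u v} → Star _~_ u v → Via (allFin n) u v
    complete ε       = via-refl (allFin n)
    complete (e ◅ p) = via-trans (∈-allFin _) (via-edge (allFin n) e) (complete p)

  star? : Decidable (Star _~_)
  star? u v = map′ (sound (allFin n)) complete (via? (allFin n) u v)

reachable? : ∀ {n} (G : Multigraph n) → Decidable (Reachable G)
reachable? G = star? (λ u v → 0 <? mult G u v)

-- Keeping one vertex from each class of mutually reachable vertices.
ω : ∀ {n} → Multigraph n → ℕ
ω G = length (deduplicate (reachable? G) (allFin _))

iso : ∀ {n} → Multigraph n → ℕ
iso G = length (filter (λ v → deg G v ≟ 0) (allFin _))

-- The increasing enumeration of the elements of a subset.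
embed : ∀ {n} (P : Subset n) → Fin ∣ P ∣ → Fin n
embed (outside ∷ P) i       = suc (embed P i)
embed (inside  ∷ P) zero    = zero
embed (inside  ∷ P) (suc i) = suc (embed P i)

-- Vertex deletion; the remaining vertices are renumbered by embed (∁ S).
_∖_ : ∀ {n} → Multigraph n → (S : Subset n) → Multigraph ∣ ∁ S ∣
G ∖ S = record
  { mult     = λ i j → mult G (embed (∁ S) i) (embed (∁ S) j)
  ; mult-sym = λ i j → mult-sym G (embed (∁ S) i) (embed (∁ S) j)
  ; loopless = λ i → loopless G (embed (∁ S) i)
  }

_IsSpanningSubgraphOf_ : ∀ {n} → Multigraph n → Multigraph n → Set
H IsSpanningSubgraphOf G = ∀ u v → mult H u v ≤ mult G u v

IsFactor : ∀ {n} → Pred ℤ 0ℓ → Multigraph n → Multigraph n → Set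
IsFactor A G H = H IsSpanningSubgraphOf G × (∀ v → A (+ deg H v))

fromℕ : ℕ → ℚ
fromℕ k = + k / 1

module Submission where

-- Call a set H of edges sparse if every nonempty vertex set X spans at most 2|X| - 2 of them, and call X
-- tight if equality holds. A sparse H with 2n - 2 edges is the union of two edge-disjoint connected spanning
-- subgraphs T₁ and T₂ (Henneberg: induct by removing a vertex of degree 2 or 3). The sum modulo 2 of T₂-paths
-- joining the ends of each edge of T₁ has the degree parities of T₁, so adding it to T₁ gives a connected
-- spanning even subgraph. It remains to find such an H in G with all degrees at most 5.
--
-- Let H be sparse with degrees at most 5 and fewer edges, and let S be the set of its vertices of degree 5.
-- If some edge xy of G outside S is not in H and no tight set outside S contains x and y, then either H + xy
-- is sparse, or a smallest tight set W around x and y meets S; exchanging xy for an edge of W at a vertex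
-- of S shows how that vertex can be desaturated, so W is removed from S. Vertices that left S are
-- desaturated by changes inside disjoint tight sets, which do not interfere. When no such edge is left, let p
-- be the number of maximal tight sets outside S and e the number of edges of G outside S between them. These
-- edges are all in H, and counting the edges of H gives 2p - e ≥ |S| + 3.
--
-- On the other hand 2p + 3 iso(G - S) ≤ |S| + 2 + e for every partition of the complement of S into p classes.
-- For e = 0 this is the hypothesis, and otherwise suitable ends of crossing edges can be moved into S
-- without decreasing 2p + 3 iso(G - S) - |S| - e.

open import Data.Nat.Base
open import Data.Nat.Properties
open import Data.Nat.Induction using (<-wellFounded)
open import Data.Nat.Tactic.RingSolver using (solve-∀)
open import Data.Parity.Base as ℙ using (0ℙ)
import Data.Parity.Properties as ℙ
import Data.Integer.Base as ℤ
import Data.Integer.Properties as ℤ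
open import Data.Rational.Base as ℚ using (½; 1ℚ)
import Data.Rational.Properties as ℚ
import Data.Rational.Unnormalised.Base as ℚᵘ
import Data.Rational.Unnormalised.Properties as ℚᵘ
open import Data.Bool.Base using (Bool; true; false; not; _∧_; _∨_; T)
import Data.Bool.Properties as Bool
open import Data.Fin.Base using (Fin; zero; suc)
import Data.Fin.Properties as Fin
open import Data.Fin.Subset using (Subset; ∣_∣; ∁)
open import Data.Fin.Subset.Properties using (anySubset?)
open import Data.Vec.Base using ([]; _∷_; lookup; tabulate)
open import Data.Vec.Properties using (lookup∘tabulate; lookup-map)
open import Data.List.Base as List
  using (List; []; _∷_; _++_; length; filter; filterᵇ; deduplicate; allFin)
open import Data.List.Properties using (length-++)
open import Data.List.Membership.Propositional using (_∈_)
open import Data.List.Membership.Propositional.Properties using (∈-++⁻; ∈-++⁺ˡ; ∈-∃++; ∈-allFin)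
open import Data.List.Relation.Unary.All as All using (All; []; _∷_)
open import Data.List.Relation.Unary.Any as Any using (Any; here; there)
import Data.List.Relation.Unary.Any.Properties as Any
open import Data.List.Relation.Binary.Permutation.Propositional as Perm using (_↭_; prep; swap; ↭-sym)
open import Data.List.Relation.Binary.Permutation.Propositional.Properties
  using (∈-resp-↭; shift; drop-∷; ++-comm; ++-assoc; ++⁺ˡ; ++⁺ʳ; ↭-length)
open import Data.Maybe.Base as Maybe using (Maybe; just; nothing; fromMaybe)
open import Data.Product.Base using (∃; ∃₂; ∃-syntax; _×_; _,_; proj₁; proj₂)
open import Data.Sum.Base using (_⊎_; inj₁; inj₂; [_,_]′)
open import Data.Empty using (⊥; ⊥-elim)
open import Function.Base using (_∘_; id; const)
open import Induction.WellFounded using (Acc; acc)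
open import Relation.Nullary using (¬_; Dec; yes; no; does; contradiction)
open import Relation.Nullary.Decidable using (_×-dec_; _→-dec_; ¬?; dec-true; dec-false)
open import Relation.Unary using (｛_｝; _∪_)
open import Relation.Binary.Construct.Closure.ReflexiveTransitive as Star using (Star; ε; _◅_; _◅◅_)
open import Relation.Binary.PropositionalEquality hiding (J)
open import Algebra.Properties.CommutativeMonoid.Sum +-0-commutativeMonoid
  using (sum; sum-cong-≗; ∑-distrib-+; ∑-comm)
open import Defs

private variable
  n : ℕ

-- Indicators and linear arithmetic

𝟙 : Bool → ℕ
𝟙 true  = 1
𝟙 false = 0

-- Linear arithmetic in one step: the available inequalities are added up to `a ≤ b`, and the other
-- premise is then usually an identity for the ring solver.
cancel-≤ : ∀ {x y a b} → a ≤ b → x + b ≤ y + a → x ≤ y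
cancel-≤ {x} {y} {a} {b} a≤b h = +-cancelʳ-≤ b x y (≤-trans h (+-monoʳ-≤ y a≤b))

-- Pointwise inequalities between functions of Booleans, by truth table.

Fun : ℕ → Set
Fun zero    = ℕ
Fun (suc k) = Bool → Fun k

Pointwise : ∀ k → Fun k → Fun k → Set
Pointwise zero    f g = f ≤ g
Pointwise (suc k) f g = ∀ a → Pointwise k (f a) (g a)

check : ∀ k → Fun k → Fun k → Bool
check zero    f g = f ≤ᵇ g
check (suc k) f g = check k (f true) (g true) ∧ check k (f false) (g false)

T-∧ˡ : ∀ {a b} → T (a ∧ b) → T a
T-∧ˡ {true} _ = _

T-∧ʳ : ∀ {a b} → T (a ∧ b) → T b
T-∧ʳ {true} t = t

truthTable : ∀ k (f g : Fun k) {_ : T (check k f g)} → Pointwise k f g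
truthTable zero    f g {t} = ≤ᵇ⇒≤ f g t
truthTable (suc k) f g {t} true  = truthTable k _ _ {T-∧ˡ t}
truthTable (suc k) f g {t} false = truthTable k _ _ {T-∧ʳ {check k (f true) (g true)} t}

∧-true : ∀ {a b} → a ∧ b ≡ true → a ≡ true × b ≡ true
∧-true {true} {true} _ = refl , refl

not-true : ∀ {a} → not a ≡ true → a ≡ false
not-true {false} _ = refl

true≢false : ∀ {a} → a ≡ true → a ≡ false → ⊥
true≢false refl ()

𝟙-positive : ∀ {b} → 0 < 𝟙 b → b ≡ true
𝟙-positive {true} _ = refl

bool-cases : ∀ a → a ≡ true ⊎ a ≡ false
bool-cases true  = inj₁ refl
bool-cases false = inj₂ refl

module _ {P : Set} where

  does-true : (P? : Dec P) → does P? ≡ true → P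
  does-true (yes p) _ = p

  does-false : (P? : Dec P) → does P? ≡ false → ¬ P
  does-false (no ¬p) _ = ¬p

module _ {P Q : Set} where

  𝟙-does-mono : (P? : Dec P) (Q? : Dec Q) → (P → Q) → 𝟙 (does P?) ≤ 𝟙 (does Q?)
  𝟙-does-mono (no _)  _       _   = z≤n
  𝟙-does-mono (yes _) (yes _) _   = ≤-refl
  𝟙-does-mono (yes p) (no ¬q) P⇒Q = contradiction (P⇒Q p) ¬q

  𝟙-does-strict : (P? : Dec P) (Q? : Dec Q) → ¬ P → Q → 𝟙 (does P?) < 𝟙 (does Q?)
  𝟙-does-strict (yes p) _       ¬p _ = contradiction p ¬p
  𝟙-does-strict (no _)  (yes _) _  _ = ≤-refl
  𝟙-does-strict (no _)  (no ¬q) _  q = contradiction q ¬q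

-- Sums over Fin n

sum-mono : ∀ {n} {f g : Fin n → ℕ} → (∀ v → f v ≤ g v) → sum f ≤ sum g
sum-mono {zero}  h = z≤n
sum-mono {suc n} h = +-mono-≤ (h zero) (sum-mono (h ∘ suc))

sum-zero : ∀ {n} {f : Fin n → ℕ} → (∀ v → f v ≡ 0) → sum f ≡ 0
sum-zero {zero}  h = refl
sum-zero {suc n} h = cong₂ _+_ (h zero) (sum-zero (h ∘ suc))

sum-* : ∀ {n} c (f : Fin n → ℕ) → sum (λ v → c * f v) ≡ c * sum f
sum-* {zero}  c f = sym (*-zeroʳ c)
sum-* {suc n} c f = trans (cong (c * f zero +_) (sum-* c (f ∘ suc))) (sym (*-distribˡ-+ c (f zero) _))

sum-1 : ∀ n → sum {n} (λ _ → 1) ≡ n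
sum-1 zero    = refl
sum-1 (suc n) = cong suc (sum-1 n)

sum-≥ : ∀ {n} (f : Fin n → ℕ) v → f v ≤ sum f
sum-≥ f zero    = m≤m+n _ _
sum-≥ f (suc v) = ≤-trans (sum-≥ (f ∘ suc) v) (m≤n+m _ (f zero))

sum-strict : ∀ {n} {f g : Fin n → ℕ} → (∀ v → f v ≤ g v) → ∀ v → f v < g v → sum f < sum g
sum-strict h zero    l = +-mono-<-≤ l (sum-mono (h ∘ suc))
sum-strict h (suc v) l = +-mono-≤-< (h zero) (sum-strict (h ∘ suc) v l)

sum-positive : ∀ {n} (f : Fin n → ℕ) → 0 < sum f → ∃[ v ] 0 < f v
sum-positive {suc n} f h with f zero in eq
... | suc k = zero , subst (0 <_) (sym eq) z<s
... | zero  with v , l ← sum-positive (f ∘ suc) h = suc v , l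

δ : ∀ {n} → Fin n → Fin n → ℕ
δ u v = 𝟙 (does (u Fin.≟ v))

δ-refl : ∀ {n} (v : Fin n) → δ v v ≡ 1
δ-refl v with v Fin.≟ v
... | yes _ = refl
... | no ¬p = contradiction refl ¬p

δ-≢ : ∀ {n} {u v : Fin n} → u ≢ v → δ u v ≡ 0
δ-≢ {u = u} {v} ¬p with u Fin.≟ v
... | yes p = contradiction p ¬p
... | no _  = refl

δ-sym : ∀ {n} (u v : Fin n) → δ u v ≡ δ v u
δ-sym u v with u Fin.≟ v
... | yes refl = sym (δ-refl u)
... | no ¬p    = sym (δ-≢ (¬p ∘ sym))

δ-suc : ∀ {n} (u v : Fin n) → δ (suc u) (suc v) ≡ δ u v
δ-suc u v with u Fin.≟ v
... | yes p = refl
... | no ¬p = refl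

sum-δ : ∀ {n} (a : Fin n) (f : Fin n → ℕ) → sum (λ v → δ a v * f v) ≡ f a
sum-δ {suc n} zero f =
  trans (cong₂ _+_ (+-identityʳ (f zero)) (sum-zero {f = λ v → δ zero (suc v) * f (suc v)} (λ _ → refl))) (+-identityʳ _)
sum-δ {suc n} (suc a) f =
  trans (sum-cong-≗ (λ v → cong (_* f (suc v)) (δ-suc a v))) (sum-δ a (f ∘ suc))

sum-δ₁ : ∀ {n} (a : Fin n) → sum (δ a) ≡ 1
sum-δ₁ a = trans (sum-cong-≗ (λ v → sym (*-identityʳ (δ a v)))) (sum-δ a (const 1))

-- Sums over lists

module _ {A : Set} where

  tot : (A → ℕ) → List A → ℕ
  tot g []      = 0
  tot g (e ∷ H) = g e + tot g H

  tot-cong : ∀ {g h} → (∀ e → g e ≡ h e) → ∀ H → tot g H ≡ tot h H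
  tot-cong eq []      = refl
  tot-cong eq (e ∷ H) = cong₂ _+_ (eq e) (tot-cong eq H)

  tot-mono : ∀ {g h} → (∀ e → g e ≤ h e) → ∀ H → tot g H ≤ tot h H
  tot-mono le []      = z≤n
  tot-mono le (e ∷ H) = +-mono-≤ (le e) (tot-mono le H)

  tot-++ : ∀ g H J → tot g (H ++ J) ≡ tot g H + tot g J
  tot-++ g []      J = refl
  tot-++ g (e ∷ H) J = trans (cong (g e +_) (tot-++ g H J)) (sym (+-assoc (g e) _ _))

  tot-+ : ∀ g h H → tot (λ e → g e + h e) H ≡ tot g H + tot h H
  tot-+ g h []      = refl
  tot-+ g h (e ∷ H) = trans (cong (g e + h e +_) (tot-+ g h H)) (interchange (g e) (h e) _ _)
    where
    interchange : ∀ a b c d → a + b + (c + d) ≡ a + c + (b + d)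
    interchange = solve-∀

  tot-zero : ∀ {g} → (∀ e → g e ≡ 0) → ∀ H → tot g H ≡ 0
  tot-zero eq []      = refl
  tot-zero eq (e ∷ H) = cong₂ _+_ (eq e) (tot-zero eq H)

  tot-1 : ∀ H → tot (λ _ → 1) H ≡ length H
  tot-1 []      = refl
  tot-1 (e ∷ H) = cong suc (tot-1 H)

  tot-filter : ∀ g p H → tot g (filterᵇ p H) ≡ tot (λ e → 𝟙 (p e) * g e) H
  tot-filter g p []      = refl
  tot-filter g p (e ∷ H) with p e
  ... | true  = cong₂ _+_ (sym (+-identityʳ (g e))) (tot-filter g p H)
  ... | false = tot-filter g p H

  tot-split : ∀ (p : A → Bool) g H →
    tot g H ≡ tot (λ e → 𝟙 (not (p e)) * g e) H + tot (λ e → 𝟙 (p e) * g e) H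
  tot-split p g H = trans (tot-cong (λ e → split (p e) (g e)) H) (tot-+ _ _ H)
    where
    split : ∀ b k → k ≡ 𝟙 (not b) * k + 𝟙 b * k
    split true  k = sym (+-identityʳ k)
    split false k = sym (trans (+-identityʳ _) (+-identityʳ k))

  tot-↭ : ∀ g {H J} → H ↭ J → tot g H ≡ tot g J
  tot-↭ g Perm.refl          = refl
  tot-↭ g (prep e p)         = cong (g e +_) (tot-↭ g p)
  tot-↭ g (swap e f p) = trans (cong (λ k → g e + (g f + k)) (tot-↭ g p)) (comm (g e) (g f) _)
    where
    comm : ∀ a b c → a + (b + c) ≡ b + (a + c)
    comm = solve-∀
  tot-↭ g (Perm.trans p q)   = trans (tot-↭ g p) (tot-↭ g q)

  tot-positive : ∀ g H → 0 < tot g H → ∃₂ λ f J → 0 < g f × H ↭ f ∷ J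
  tot-positive g (e ∷ H) l with g e in eq
  ... | suc k = e , H , subst (0 <_) (sym eq) z<s , Perm.refl
  ... | zero  with f , J , pos , p ← tot-positive g H l =
    f , e ∷ J , pos , Perm.trans (prep e p) (swap e f Perm.refl)

  sum-tot : ∀ {n} (g : Fin n → A → ℕ) H → sum (λ v → tot (g v) H) ≡ tot (λ e → sum (λ v → g v e)) H
  sum-tot {n} g []      = sum-zero {f = λ (_ : Fin n) → 0} (λ _ → refl)
  sum-tot g (e ∷ H) =
    trans (∑-distrib-+ (λ v → g v e) (λ v → tot (g v) H)) (cong (sum (λ v → g v e) +_) (sum-tot g H))

-- Vertex sets, edge lists and sparsity

VSet : ℕ → Set
VSet n = Fin n → Bool

-- Subgraphs under construction are lists of ordered pairs. Parallel edges are repeated entries;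
-- order and orientation carry no meaning.
Edge : ℕ → Set
Edge n = Fin n × Fin n

infixr 6 _∪ᵛ_
infixr 7 _∩ᵛ_
infixl 7 _-ᵛ_

_∪ᵛ_ _∩ᵛ_ : VSet n → VSet n → VSet n
(X ∪ᵛ Y) v = X v ∨ Y v
(X ∩ᵛ Y) v = X v ∧ Y v

_-ᵛ_ : VSet n → Fin n → VSet n
(X -ᵛ v) u = X u ∧ not (does (u Fin.≟ v))

_⊆ᵛ_ : VSet n → VSet n → Set
X ⊆ᵛ Y = ∀ v → X v ≡ true → Y v ≡ true

card : VSet n → ℕ
card X = sum (𝟙 ∘ X)

inside : VSet n → Edge n → Bool
inside X (a , b) = X a ∧ X b

inc : Fin n → Edge n → ℕ
inc v (a , b) = δ a v + δ b v

-- The number of edges spanned by a set; `d` below is the degree.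
i : List (Edge n) → VSet n → ℕ
i H X = tot (𝟙 ∘ inside X) H

d : List (Edge n) → Fin n → ℕ
d H v = tot (inc v) H

-- By Nash-Williams, this says that H is a union of two forests.
Sparse : List (Edge n) → Set
Sparse H = ∀ X v → X v ≡ true → i H X + 2 ≤ 2 * card X

-- Sparsity gives the reverse inequality for nonempty sets; the empty set counts as tight too.
Tight : List (Edge n) → VSet n → Set
Tight H X = 2 * card X ≤ i H X + 2

-- Vertex sets

∪-introˡ : ∀ (X Y : VSet n) {v} → X v ≡ true → (X ∪ᵛ Y) v ≡ true
∪-introˡ X Y h rewrite h = refl

∪-introʳ : ∀ (X Y : VSet n) {v} → Y v ≡ true → (X ∪ᵛ Y) v ≡ true
∪-introʳ X Y {v} h rewrite h = Bool.∨-zeroʳ (X v)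

∪-elim : ∀ (X Y : VSet n) {v} → (X ∪ᵛ Y) v ≡ true → X v ≡ true ⊎ Y v ≡ true
∪-elim X Y {v} h with X v
... | true  = inj₁ refl
... | false = inj₂ h

∩-intro : ∀ (X Y : VSet n) {v} → X v ≡ true → Y v ≡ true → (X ∩ᵛ Y) v ≡ true
∩-intro X Y h k rewrite h | k = refl

-ᵛ-intro : ∀ (X : VSet n) {u v} → X u ≡ true → u ≢ v → (X -ᵛ v) u ≡ true
-ᵛ-intro X {u} {v} h ≢ with u Fin.≟ v
... | yes p = contradiction p ≢
... | no _  = trans (Bool.∧-identityʳ _) h

card-modular : ∀ (X Y : VSet n) → card X + card Y ≡ card (X ∪ᵛ Y) + card (X ∩ᵛ Y)
card-modular X Y =
  trans (sym (∑-distrib-+ (𝟙 ∘ X) (𝟙 ∘ Y)))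
 (trans (sum-cong-≗ (λ v → eq (X v) (Y v))) (∑-distrib-+ (𝟙 ∘ (X ∪ᵛ Y)) (𝟙 ∘ (X ∩ᵛ Y))))
  where
  eq : ∀ a b → 𝟙 a + 𝟙 b ≡ 𝟙 (a ∨ b) + 𝟙 (a ∧ b)
  eq true  true  = refl
  eq true  false = refl
  eq false true  = refl
  eq false false = refl

card-remove : ∀ (X : VSet n) {v} → X v ≡ true → card X ≡ suc (card (X -ᵛ v))
card-remove X {v} Xv =
  trans (sum-cong-≗ eq) (trans (∑-distrib-+ (δ v) (𝟙 ∘ (X -ᵛ v))) (cong (_+ card (X -ᵛ v)) (sum-δ₁ v)))
  where
  eq : ∀ u → 𝟙 (X u) ≡ δ v u + 𝟙 ((X -ᵛ v) u)
  eq u rewrite δ-sym v u with u Fin.≟ v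
  ... | yes refl rewrite Xv = refl
  ... | no _ = cong 𝟙 (sym (Bool.∧-identityʳ (X u)))

card-≗ : {X Y : VSet n} → X ≗ Y → card X ≡ card Y
card-≗ eq = sum-cong-≗ (cong 𝟙 ∘ eq)

card-positive : ∀ (X : VSet n) {v} → X v ≡ true → 0 < card X
card-positive X {v} Xv = ≤-trans (≤-reflexive (sym (cong 𝟙 Xv))) (sum-≥ (𝟙 ∘ X) v)

card-empty : ∀ (X : VSet n) → ¬ (∃[ v ] X v ≡ true) → card X ≡ 0
card-empty X none = sum-zero empty
  where
  empty : ∀ v → 𝟙 (X v) ≡ 0
  empty v with X v in eq
  ... | true  = contradiction (v , eq) none
  ... | false = refl

card-∪-≤ : ∀ (X Y : VSet n) → card (X ∪ᵛ Y) ≤ card X + card Y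
card-∪-≤ X Y = ≤-trans (m≤m+n _ _) (≤-reflexive (sym (card-modular X Y)))

i-≗ : ∀ (H : List (Edge n)) {X Y} → X ≗ Y → i H X ≡ i H Y
i-≗ H eq = tot-cong (λ (a , b) → cong 𝟙 (cong₂ _∧_ (eq a) (eq b))) H

-- Edge by edge: an edge inside `X` or `Y` lies inside the union, and an edge inside both lies
-- inside the intersection as well.
i-supermodular : ∀ (H : List (Edge n)) X Y → i H X + i H Y ≤ i H (X ∪ᵛ Y) + i H (X ∩ᵛ Y)
i-supermodular H X Y =
  ≤-trans (≤-reflexive (sym (tot-+ _ _ H)))
 (≤-trans (tot-mono (λ (a , b) → super (X a) (X b) (Y a) (Y b)) H) (≤-reflexive (tot-+ _ _ H)))
  where
  super = truthTable 4 (λ a b c d → 𝟙 (a ∧ b) + 𝟙 (c ∧ d))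
                       (λ a b c d → 𝟙 ((a ∨ c) ∧ (b ∨ d)) + 𝟙 ((a ∧ c) ∧ (b ∧ d)))

-- Unions and intersections of tight sets

module _ {H : List (Edge n)} (sp : Sparse H) {X Y : VSet n} (tX : Tight H X) (tY : Tight H Y) where

  private
    total : ∀ {c} → c ≡ card X + card Y → 2 * c ≤ i H (X ∪ᵛ Y) + i H (X ∩ᵛ Y) + 4
    total refl =
      ≤-trans (≤-reflexive (*-distribˡ-+ 2 (card X) (card Y)))
     (≤-trans (+-mono-≤ tX tY)
     (≤-trans (≤-reflexive (eq (i H X) (i H Y))) (+-monoˡ-≤ 4 (i-supermodular H X Y))))
      where
      eq : ∀ a b → a + 2 + (b + 2) ≡ a + b + 4
      eq = solve-∀

    total′ = total (sym (card-modular X Y))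

  -- By supermodularity, union and intersection together span at least 2|X ∪ Y| + 2|X ∩ Y| - 4
  -- edges. The intersection contains `z`, so sparsity grants it at most 2|X ∩ Y| - 2 of them, and
  -- the union must span the rest.
  tight-∪ : ∀ {z} → X z ≡ true → Y z ≡ true → Tight H (X ∪ᵛ Y)
  tight-∪ {z} Xz Yz = cancel-≤ (+-mono-≤ total′ (sp (X ∩ᵛ Y) z (∩-intro X Y Xz Yz)))
    (≤-reflexive (eq (card (X ∪ᵛ Y)) (card (X ∩ᵛ Y)) (i H (X ∪ᵛ Y)) (i H (X ∩ᵛ Y))))
    where
    eq : ∀ a b c e → 2 * a + (c + e + 4 + 2 * b) ≡ c + 2 + (2 * (a + b) + (e + 2))
    eq = solve-∀

  -- The same count with sparsity applied to the union.
  tight-∩ : ∀ {z} → X z ≡ true → Tight H (X ∩ᵛ Y)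
  tight-∩ {z} Xz = cancel-≤ (+-mono-≤ total′ (sp (X ∪ᵛ Y) z (∪-introˡ X Y Xz)))
    (≤-reflexive (eq (card (X ∪ᵛ Y)) (card (X ∩ᵛ Y)) (i H (X ∪ᵛ Y)) (i H (X ∩ᵛ Y))))
    where
    eq : ∀ a b c e → 2 * b + (c + e + 4 + 2 * a) ≡ e + 2 + (2 * (a + b) + (c + 2))
    eq = solve-∀

-- Decidable search among vertex sets

module _ {P : VSet n → Set} (resp : ∀ {X Y} → X ≗ Y → P X → P Y) (P? : ∀ X → Dec (P X)) where

  -- The search runs over Boolean vectors. A set agrees with its tabulation only pointwise, hence
  -- `resp`.
  findSet : Dec (∃ P)
  findSet with anySubset? (P? ∘ lookup)
  ... | yes (S , p) = yes (lookup S , p)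
  ... | no ¬p = no λ (X , p) → ¬p (tabulate X , resp (λ v → sym (lookup∘tabulate X v)) p)

module _ {P : VSet n → Set} (resp : ∀ {X Y} → X ≗ Y → P X → P Y) (P? : ∀ X → Dec (P X)) where

  smallest : ∀ X → P X → ∃[ W ] (P W × ∀ Y → P Y → card W ≤ card Y)
  smallest X = go X (<-wellFounded (card X))
    where
    go : ∀ X → Acc _<_ (card X) → P X → ∃[ W ] (P W × ∀ Y → P Y → card W ≤ card Y)
    go X (acc rs) p
      with findSet {P = λ Y → P Y × card Y < card X}
             (λ eq (q , l) → resp eq q , subst (_< card X) (card-≗ eq) l)
             (λ Y → P? Y ×-dec (card Y <? card X))
    ... | yes (Y , q , l) = go Y (rs l) q
    ... | no ¬q = X , p , λ Y q → ≮⇒≥ (λ l → ¬q (Y , q , l))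

-- Tight sets around two vertices, and exchanging edges

TightAround : List (Edge n) → Fin n → Fin n → VSet n → Set
TightAround H x y X = X x ≡ true × X y ≡ true × Tight H X

tight-≗ : ∀ {H : List (Edge n)} {X Y} → X ≗ Y → Tight H X → Tight H Y
tight-≗ {H = H} eq t = subst₂ (λ c k → 2 * c ≤ k + 2) (card-≗ eq) (i-≗ H eq) t

tight? : ∀ (H : List (Edge n)) X → Dec (Tight H X)
tight? H X = 2 * card X ≤? i H X + 2

tightAround-≗ : ∀ {H : List (Edge n)} {x y X Y} → X ≗ Y → TightAround H x y X → TightAround H x y Y
tightAround-≗ {H = H} eq (p , q , t) = trans (sym (eq _)) p , trans (sym (eq _)) q , tight-≗ {H = H} eq t

tightAround? : ∀ (H : List (Edge n)) x y X → Dec (TightAround H x y X)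
tightAround? H x y X = (X x Bool.≟ true) ×-dec ((X y Bool.≟ true) ×-dec tight? H X)

-- A new edge violates sparsity only at a set that contains both of its ends and has no room left,
-- that is, at a tight set.
sparse-or-tight : ∀ {H : List (Edge n)} → Sparse H → ∀ x y →
  Sparse ((x , y) ∷ H) ⊎ ∃ (TightAround H x y)
sparse-or-tight {H = H} sp x y with findSet (tightAround-≗ {H = H}) (tightAround? H x y)
... | yes t  = inj₂ t
... | no ¬t = inj₁ sp′
  where
  sp′ : Sparse ((x , y) ∷ H)
  sp′ X v Xv with X x in eqx | X y in eqy
  ... | false | _     = sp X v Xv
  ... | true  | false = sp X v Xv
  ... | true  | true  = ≰⇒> (λ t → ¬t (X , eqx , eqy , t))

-- Tight sets around `x` and `y` are closed under intersection, so one of least cardinality is least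
-- for inclusion.
smallest-tight : ∀ {H : List (Edge n)} → Sparse H → ∀ {x y} → ∃ (TightAround H x y) →
  ∃[ W ] (TightAround H x y W × ∀ Y → TightAround H x y Y → W ⊆ᵛ Y)
smallest-tight {H = H} sp {x} {y} (X , p)
  with W , (Wx , Wy , tW) , least ← smallest (tightAround-≗ {H = H}) (tightAround? H x y) X p =
  W , (Wx , Wy , tW) , below
  where
  below : ∀ Y → TightAround H x y Y → W ⊆ᵛ Y
  below Y (Yx , Yy , tY) v Wv with Y v in eq
  ... | true  = refl
  ... | false = contradiction
    (least (W ∩ᵛ Y) (∩-intro W Y Wx Yx , ∩-intro W Y Wy Yy , tight-∩ {H = H} sp tW tY {x} Wx))
    (<⇒≱ (sum-strict (λ u → mono (W u) (Y u)) v strict))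
    where
    mono = truthTable 2 (λ a b → 𝟙 (a ∧ b)) (λ a b → 𝟙 a)
    strict : 𝟙 (W v ∧ Y v) < 𝟙 (W v)
    strict rewrite Wv | eq = ≤-refl

module _ {H : List (Edge n)} (sp : Sparse H) {x y : Fin n} {W : VSet n}
         (around : TightAround H x y W) (least : ∀ Y → TightAround H x y Y → W ⊆ᵛ Y)
         {v : Fin n} (Wv : W v ≡ true) (x≢v : x ≢ v) where

  private
    g : Edge n → ℕ
    g e = 𝟙 (inside W e) * inc v e

    i-remove : i H W ≤ i H (W -ᵛ v) + tot g H
    i-remove = ≤-trans (tot-mono (λ (a , b) → le (W a) (W b) (does (a Fin.≟ v)) (does (b Fin.≟ v))) H)
                       (≤-reflexive (tot-+ _ _ H))
      where
      le = truthTable 4 (λ a b c d → 𝟙 (a ∧ b))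
                        (λ a b c d → 𝟙 ((a ∧ not c) ∧ (b ∧ not d)) + 𝟙 (a ∧ b) * (𝟙 c + 𝟙 d))

    -- `W` spans 2|W| - 2 edges, whereas `W -ᵛ v`, nonempty because it contains `x`, spans at most
    -- 2|W| - 4. The difference consists of edges at `v`.
    2≤g : 2 ≤ tot g H
    2≤g = cancel-≤ (+-mono-≤ (+-mono-≤ (subst (λ c → 2 * c ≤ i H W + 2) (card-remove W Wv) (proj₂ (proj₂ around)))
                                       i-remove)
                             (sp (W -ᵛ v) x (-ᵛ-intro W (proj₁ around) x≢v)))
                   (≤-reflexive (eq (card (W -ᵛ v)) (i H W) (i H (W -ᵛ v)) (tot g H)))
      where
      eq : ∀ a b c k → 2 + (b + 2 + (c + k) + 2 * a) ≡ k + (2 * suc a + b + (c + 2))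
      eq = solve-∀

    factors : ∀ f → 0 < g f → inside W f ≡ true × 0 < inc v f
    factors f pos with inside W f
    ... | true = refl , subst (0 <_) (+-identityʳ (inc v f)) pos

    -- A set around `x` and `y` that is not tight has room for one more edge. A tight one contains
    -- `W`, hence loses `f` when it gains the new edge.
    exchange-sparse : ∀ {f J} → H ↭ f ∷ J → inside W f ≡ true → Sparse ((x , y) ∷ J)
    exchange-sparse {f} {J} p Wf X u Xu with X x in eqx | X y in eqy
    ... | false | _     = ≤-trans (+-monoˡ-≤ 2 (m≤n+m (i J X) (𝟙 (inside X f))))
                            (subst (λ k → k + 2 ≤ 2 * card X) (tot-↭ (𝟙 ∘ inside X) p) (sp X u Xu))
    ... | true  | false = ≤-trans (+-monoˡ-≤ 2 (m≤n+m (i J X) (𝟙 (inside X f))))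
                            (subst (λ k → k + 2 ≤ 2 * card X) (tot-↭ (𝟙 ∘ inside X) p) (sp X u Xu))
    ... | true  | true  with tight? H X
    ... | no ¬t = ≤-trans (s≤s (≤-trans (+-monoˡ-≤ 2 (m≤n+m (i J X) (𝟙 (inside X f))))
                                        (≤-reflexive (cong (_+ 2) (sym (tot-↭ (𝟙 ∘ inside X) p))))))
                          (≰⇒> ¬t)
    ... | yes t = subst (λ k → k + 2 ≤ 2 * card X)
                    (trans (tot-↭ (𝟙 ∘ inside X) p) (cong (λ b → 𝟙 b + i J X) Xf)) (sp X u Xu)
      where
      Xf : inside X f ≡ true
      Xf = cong₂ _∧_ (least X (eqx , eqy , t) _ (proj₁ (∧-true Wf))) (least X (eqx , eqy , t) _ (proj₂ (∧-true Wf)))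

  exchange : ∃₂ λ f J → H ↭ f ∷ J × inside W f ≡ true × 0 < inc v f × Sparse ((x , y) ∷ J)
  exchange =
    let f , J , pos , p = tot-positive g H (≤-trans (s≤s z≤n) 2≤g)
        Wf , v∈f        = factors f pos
    in f , J , p , Wf , v∈f , exchange-sparse p Wf

-- Multiplicities, and edge lists that differ only inside one set

at : Fin n → Fin n → Edge n → ℕ
at u v (a , b) = δ a u * δ b v + δ a v * δ b u

-- `at` accepts both orientations and counts a loop twice, so `m` is a symmetric matrix whose row
-- sums are the degrees.
m : List (Edge n) → Fin n → Fin n → ℕ
m H u v = tot (at u v) H

m-sym : ∀ (H : List (Edge n)) u v → m H u v ≡ m H v u
m-sym H u v = tot-cong (λ (a , b) → +-comm (δ a u * δ b v) _) H

VanishesOn : VSet n → (Edge n → ℕ) → Set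
VanishesOn K g = ∀ e → inside K e ≡ true → g e ≡ 0

-- Equality, up to order, of the edges with an end outside `K`, expressed through weights. Degrees,
-- multiplicities and spanned edges are all totals of weights, so one condition covers them.
AgreeOutside : VSet n → List (Edge n) → List (Edge n) → Set
AgreeOutside K H H′ = ∀ g → VanishesOn K g → tot g H ≡ tot g H′

inside-mono : ∀ {K L : VSet n} → K ⊆ᵛ L → ∀ e → inside K e ≡ true → inside L e ≡ true
inside-mono K⊆L (a , b) h = cong₂ _∧_ (K⊆L a (proj₁ (∧-true h))) (K⊆L b (proj₂ (∧-true h)))

δ-∉ : ∀ (K : VSet n) {a w} → K a ≡ true → K w ≡ false → δ a w ≡ 0
δ-∉ {n} K {a} {w} Ka Kw = δ-≢ {u = a} {w} λ { refl → true≢false Ka Kw }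

inc-vanishes : ∀ {K : VSet n} {w} → K w ≡ false → VanishesOn K (inc w)
inc-vanishes {K = K} Kw (a , b) h =
  cong₂ _+_ (δ-∉ K (proj₁ (∧-true h)) Kw) (δ-∉ K (proj₂ (∧-true h)) Kw)

at-vanishes : ∀ {K : VSet n} {u v} → K u ∧ K v ≡ false → VanishesOn K (at u v)
at-vanishes {K = K} {u} {v} Kuv (a , b) h with K u in eq
... | false = cong₂ _+_ (cong (_* δ b v) (δ-∉ K (proj₁ (∧-true h)) eq))
                        (trans (cong (δ a v *_) (δ-∉ K (proj₂ (∧-true h)) eq)) (*-zeroʳ (δ a v)))
... | true  = cong₂ _+_ (trans (cong (δ a u *_) (δ-∉ K (proj₂ (∧-true h)) Kuv)) (*-zeroʳ (δ a u)))
                        (cong (_* δ b u) (δ-∉ K (proj₁ (∧-true h)) Kuv))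

-- A weight equal to 1 inside `K` splits into one that vanishes there and the indicator of being
-- inside `K`.
agree-1 : ∀ {K : VSet n} {H H′} → AgreeOutside K H H′ → i H K ≡ i H′ K →
  ∀ g → (∀ e → inside K e ≡ true → g e ≡ 1) → tot g H ≡ tot g H′
agree-1 {K = K} {H} {H′} ag eq g one =
  trans (split H) (trans (cong₂ _+_ (ag _ outside) eq) (sym (split H′)))
  where
  outside : VanishesOn K (λ e → 𝟙 (not (inside K e)) * g e)
  outside e h rewrite h = refl
  onK : ∀ e → 𝟙 (inside K e) * g e ≡ 𝟙 (inside K e)
  onK e with inside K e in h
  ... | true  = trans (+-identityʳ _) (one e h)
  ... | false = refl
  split : ∀ J → tot g J ≡ tot (λ e → 𝟙 (not (inside K e)) * g e) J + i J K
  split J = trans (tot-split (inside K) g J) (cong (tot (λ e → 𝟙 (not (inside K e)) * g e) J +_) (tot-cong onK J))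

agree-i : ∀ {K L : VSet n} {H H′} → AgreeOutside K H H′ → i H K ≡ i H′ K → K ⊆ᵛ L → i H L ≡ i H′ L
agree-i {K = K} {H = H} {H′} ag eq K⊆L = agree-1 {K = K} {H} {H′} ag eq _ (λ e h → cong 𝟙 (inside-mono K⊆L e h))

agree-length : ∀ {K : VSet n} {H H′} → AgreeOutside K H H′ → i H K ≡ i H′ K → length H ≡ length H′
agree-length {K = K} {H} {H′} ag eq = trans (sym (tot-1 H)) (trans (agree-1 {K = K} {H} {H′} ag eq _ (λ _ _ → refl)) (tot-1 H′))

Disjoint : VSet n → VSet n → Set
Disjoint K L = ∀ v → K v ≡ true → L v ≡ false

disjoint-vanishes : ∀ {K L : VSet n} → Disjoint K L → VanishesOn L (𝟙 ∘ inside K)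
disjoint-vanishes {K = K} {L} dis (a , b) h with K a in eq
... | true  = ⊥-elim (true≢false (proj₁ (∧-true h)) (dis a eq))
... | false = refl

mix : VSet n → List (Edge n) → List (Edge n) → List (Edge n)
mix K H J = filterᵇ (not ∘ inside K) H ++ filterᵇ (inside K) J

module _ {K : VSet n} {H J : List (Edge n)} where

  tot-mix : ∀ g → tot g (mix K H J) ≡
    tot (λ e → 𝟙 (not (inside K e)) * g e) H + tot (λ e → 𝟙 (inside K e) * g e) J
  tot-mix g = trans (tot-++ g (filterᵇ (not ∘ inside K) H) _)
                    (cong₂ _+_ (tot-filter g (not ∘ inside K) H) (tot-filter g (inside K) J))

  mix-agree : AgreeOutside K H (mix K H J)
  mix-agree g van = sym (trans (tot-mix g)
    (trans (cong₂ _+_ (tot-cong outside H) (tot-zero onK J)) (+-identityʳ _)))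
    where
    outside : ∀ e → 𝟙 (not (inside K e)) * g e ≡ g e
    outside e with inside K e in h
    ... | true  = sym (van e h)
    ... | false = +-identityʳ _
    onK : ∀ e → 𝟙 (inside K e) * g e ≡ 0
    onK e with inside K e in h
    ... | true  = trans (+-identityʳ _) (van e h)
    ... | false = refl

  mix-i : i (mix K H J) K ≡ i J K
  mix-i = trans (tot-mix _) (cong₂ _+_ (tot-zero (λ e → outside (inside K e)) H) (tot-cong (λ e → onK (inside K e)) J))
    where
    outside : ∀ b → 𝟙 (not b) * 𝟙 b ≡ 0
    outside true  = refl
    outside false = refl
    onK : ∀ b → 𝟙 b * 𝟙 b ≡ 𝟙 b
    onK true  = refl
    onK false = refl

  -- Let `X` meet `K`. The edges of `H` inside `X` but not inside `K` number at most i(X ∪ K) -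
  -- i(K), which is at most 2|X ∪ K| - 2|K| because `K` is tight. The edges of `J` inside X ∩ K
  -- number at most 2|X ∩ K| - 2. The sum of both bounds is 2|X| - 2.
  mix-sparse : Sparse H → Tight H K → Sparse J → Sparse (mix K H J)
  mix-sparse spH tK spJ X v Xv with Fin.any? (λ z → (X ∩ᵛ K) z Bool.≟ true)
  ... | no ¬z = ≤-trans (+-monoˡ-≤ 2 le) (spH X v Xv)
    where
    none : ∀ e → 𝟙 (inside K e) * 𝟙 (inside X e) ≡ 0
    none (a , b) with K a in eqK | X a in eqX
    ... | false | _     = refl
    ... | true  | false = *-zeroʳ (𝟙 (K b))
    ... | true  | true  = contradiction (a , ∩-intro X K eqX eqK) ¬z
    le : i (mix K H J) X ≤ i H X
    le = ≤-trans (≤-reflexive (trans (tot-mix _) (trans (cong (_ +_) (tot-zero none J)) (+-identityʳ _))))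
                 (tot-mono (λ e → truthTable 2 (λ a b → 𝟙 (not a) * 𝟙 b) (λ a b → 𝟙 b) (inside K e) (inside X e)) H)
  ... | yes (z , XKz) =
    cancel-≤ (+-mono-≤ (+-mono-≤ (spJ (X ∩ᵛ K) z XKz) (≤-trans (+-monoˡ-≤ 2 outer) (spH (X ∪ᵛ K) v (∪-introˡ X K Xv)))) tK)
      (≤-reflexive (trans (cong (λ t → t + 2 + (2 * card (X ∩ᵛ K) + 2 * card (X ∪ᵛ K) + (i H K + 2))) total)
        (trans (eq A B (card (X ∩ᵛ K)) (card (X ∪ᵛ K)) (i H K))
          (trans (cong (λ t → 2 * t + (B + 2 + (A + i H K + 2))) (sym (card-modular X K)))
            (eq′ (card X) (card K) _)))))
    where
    A = tot (λ e → 𝟙 (not (inside K e)) * 𝟙 (inside X e)) H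
    B = i J (X ∩ᵛ K)
    total : i (mix K H J) X ≡ A + B
    total = trans (tot-mix _) (cong (A +_) (tot-cong (λ (a , b) → and (K a) (K b) (X a) (X b)) J))
      where
      and : ∀ a b c d → 𝟙 (a ∧ b) * 𝟙 (c ∧ d) ≡ 𝟙 ((c ∧ a) ∧ (d ∧ b))
      and true  true  true  true  = refl
      and true  true  true  false = refl
      and true  true  false d     = refl
      and true  false true  true  = refl
      and true  false true  false = refl
      and true  false false d     = refl
      and false b     true  d     = refl
      and false b     false d     = refl
    outer : A + i H K ≤ i H (X ∪ᵛ K)
    outer = ≤-trans (≤-reflexive (sym (tot-+ _ _ H)))
      (tot-mono (λ (a , b) → truthTable 4 (λ a b c d → 𝟙 (not (c ∧ d)) * 𝟙 (a ∧ b) + 𝟙 (c ∧ d))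
                                          (λ a b c d → 𝟙 ((a ∨ c) ∧ (b ∨ d))) (X a) (X b) (K a) (K b)) H)
    eq : ∀ a b c u k → a + b + 2 + (2 * c + 2 * u + (k + 2)) ≡ 2 * (u + c) + (b + 2 + (a + k + 2))
    eq = solve-∀
    eq′ : ∀ x k r → 2 * (x + k) + r ≡ 2 * x + (r + 2 * k)
    eq′ = solve-∀

-- Common modifications of a graph inside two disjoint sets

module _ {K₁ K₂ : VSet n} (dis : Disjoint K₂ K₁) {H H₁ H₂ : List (Edge n)}
         (ag₁ : AgreeOutside K₁ H H₁) (ag₂ : AgreeOutside K₂ H H₂) where

  -- Away from `K₂` the mixture has the edges of `H₁`. The weight ignores the changes inside `K₁`,
  -- so it sees those of `H`, which are there also those of `H₂`.
  tot-mix-inner : ∀ g → VanishesOn K₁ g → tot g (mix K₂ H₁ H₂) ≡ tot g H₂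
  tot-mix-inner g van =
    trans (tot-mix {K = K₂} {H₁} {H₂} g)
   (trans (cong (_+ tot (λ e → 𝟙 (inside K₂ e) * g e) H₂) (trans (sym (ag₁ _ out₁)) (ag₂ _ out₂)))
          (sym (tot-split (inside K₂) g H₂)))
    where
    out₁ : VanishesOn K₁ (λ e → 𝟙 (not (inside K₂ e)) * g e)
    out₁ e h = trans (cong (𝟙 (not (inside K₂ e)) *_) (van e h)) (*-zeroʳ (𝟙 (not (inside K₂ e))))
    out₂ : VanishesOn K₂ (λ e → 𝟙 (not (inside K₂ e)) * g e)
    out₂ e h rewrite h = refl

  d-mix : ∀ w → d (mix K₂ H₁ H₂) w ≡ d H₁ w × K₂ w ≡ false ⊎ d (mix K₂ H₁ H₂) w ≡ d H₂ w × K₂ w ≡ true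
  d-mix w with K₂ w in eq
  ... | false = inj₁ (sym (mix-agree {K = K₂} {H₁} {H₂} (inc w) (inc-vanishes {K = K₂} eq)) , refl)
  ... | true  = inj₂ (tot-mix-inner (inc w) (inc-vanishes {K = K₁} (dis w eq)) , refl)

  m-mix : ∀ u v → m (mix K₂ H₁ H₂) u v ≡ m H₁ u v ⊎ m (mix K₂ H₁ H₂) u v ≡ m H₂ u v
  m-mix u v with K₂ u ∧ K₂ v in eq
  ... | false = inj₁ (sym (mix-agree {K = K₂} {H₁} {H₂} (at u v) (at-vanishes {K = K₂} eq)))
  ... | true  = inj₂ (tot-mix-inner (at u v) (at-vanishes {K = K₁} (cong (_∧ K₁ v) (dis u (proj₁ (∧-true eq))))))

-- Good edge lists and one exchange step

at-self : ∀ {x y : Fin n} → x ≢ y → at x y (x , y) ≡ 1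
at-self {x = x} {y} x≢y =
  cong₂ _+_ (cong₂ _*_ (δ-refl x) (δ-refl y)) (cong (_* δ y x) (δ-≢ x≢y))

at-cases : ∀ (x y u v : Fin n) → u ≡ x × v ≡ y ⊎ (u ≡ y × v ≡ x ⊎ at u v (x , y) ≡ 0)
at-cases x y u v with x Fin.≟ u | y Fin.≟ v | x Fin.≟ v | y Fin.≟ u
... | yes p | yes q | _     | _     = inj₁ (sym p , sym q)
... | _     | _     | yes p | yes q = inj₂ (inj₁ (sym q , sym p))
... | yes _ | no _  | yes _ | no _  = inj₂ (inj₂ refl)
... | yes _ | no _  | no _  | _     = inj₂ (inj₂ refl)
... | no _  | _     | yes _ | no _  = inj₂ (inj₂ refl)
... | no _  | _     | no _  | _     = inj₂ (inj₂ refl)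

module _ (G : Multigraph n) where

  Fits : List (Edge n) → Set
  Fits H = ∀ u v → m H u v ≤ mult G u v

  -- The final factor has even degrees and is taken from such a list, so the bound 5 leaves degrees
  -- of at most 4.
  record Good (H : List (Edge n)) : Set where
    field
      sparse : Sparse H
      fits   : Fits H
      deg≤5  : ∀ v → d H v ≤ 5

  open Good public

  -- H can be changed inside a tight set K avoiding S so that v gets a free degree.
  record Reducible (H : List (Edge n)) (S : VSet n) (v : Fin n) : Set where
    field
      K     : VSet n
      v∈K   : K v ≡ true
      K∌S   : Disjoint K S
      tight : Tight H K
      H′    : List (Edge n)
      good  : Good H′
      deg≤4 : d H′ v ≤ 4
      agree : AgreeOutside K H H′
      i-eq  : i H K ≡ i H′ K

  -- The invariant while `S` shrinks and `H` stays fixed: vertices in `S` are saturated, and each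
  -- vertex outside has a way to become desaturated.
  record State (H : List (Edge n)) (S : VSet n) : Set where
    field
      saturated : ∀ v → S v ≡ true → 5 ≤ d H v
      reducible : ∀ v → S v ≡ false → Reducible H S v

  adjacent-≢ : ∀ {x y} → 0 < mult G x y → x ≢ y
  adjacent-≢ {x} adj refl = contradiction (subst (0 <_) (loopless G x) adj) λ ()

  fits-∷ : ∀ {H x y} → Fits H → 0 < mult G x y → m H x y ≡ 0 → Fits ((x , y) ∷ H)
  fits-∷ {H} {x} {y} fit adj xy∉H u v with at-cases x y u v
  ... | inj₁ (refl , refl) = subst₂ (λ k l → k + l ≤ mult G x y) (sym (at-self (adjacent-≢ adj))) (sym xy∉H) adj
  ... | inj₂ (inj₁ (refl , refl)) =
    subst₂ (λ k l → k ≤ l) (m-sym ((x , y) ∷ H) x y) (mult-sym G x y)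
      (subst₂ (λ k l → k + l ≤ mult G x y) (sym (at-self (adjacent-≢ adj))) (sym xy∉H) adj)
  ... | inj₂ (inj₂ zero′) = ≤-trans (≤-reflexive (cong (_+ m H u v) zero′)) (fit u v)

  deg≤5-∷ : ∀ {H : List (Edge n)} {x y} → x ≢ y → (∀ v → d H v ≤ 5) → d H x ≤ 4 → d H y ≤ 4 → ∀ v → d ((x , y) ∷ H) v ≤ 5
  deg≤5-∷ {H} {x} {y} x≢y ≤5 dx dy v with x Fin.≟ v | y Fin.≟ v
  ... | yes refl | yes refl = contradiction refl x≢y
  ... | yes refl | no _     = s≤s dx
  ... | no _     | yes refl = s≤s dy
  ... | no _     | no _     = ≤5 v

  module Step {H : List (Edge n)} (goodH : Good H) {S : VSet n} (st : State H S)
              {x y : Fin n} (Sx : S x ≡ false) (Sy : S y ≡ false) (adj : 0 < mult G x y) (xy∉H : m H x y ≡ 0)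
              (apart : ∀ K → Disjoint K S → ¬ TightAround H x y K) where

    private
      module X = Reducible (State.reducible st x Sx)
      module Y = Reducible (State.reducible st y Sy)

      x≢y : x ≢ y
      x≢y = adjacent-≢ adj

      -- If the two sets met, their union would be a tight set outside `S` around `x` and `y`.
      K₂∌K₁ : Disjoint Y.K X.K
      K₂∌K₁ z Yz with X.K z in Xz
      ... | false = refl
      ... | true  = ⊥-elim (apart (X.K ∪ᵛ Y.K) away
        ( ∪-introˡ X.K Y.K X.v∈K , ∪-introʳ X.K Y.K Y.v∈K
        , tight-∪ {H = H} (sparse goodH) {X.K} {Y.K} X.tight Y.tight Xz Yz))
        where
        away : Disjoint (X.K ∪ᵛ Y.K) S
        away u p = [ X.K∌S u , Y.K∌S u ]′ (∪-elim X.K Y.K p)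

      -- Both ends desaturated at once: the change for `x` inside `X.K` and the change for `y`
      -- inside `Y.K`.
      H₂ : List (Edge n)
      H₂ = mix Y.K X.H′ Y.H′

      ag₁ : AgreeOutside X.K H X.H′
      ag₁ = X.agree

      ag₂ : AgreeOutside Y.K X.H′ H₂
      ag₂ = mix-agree {K = Y.K} {X.H′} {Y.H′}

      iK₂ : i X.H′ Y.K ≡ i H Y.K
      iK₂ = sym (X.agree _ (disjoint-vanishes {K = Y.K} {X.K} K₂∌K₁))

      iK₁ : i H₂ X.K ≡ i X.H′ X.K
      iK₁ = sym (ag₂ _ (disjoint-vanishes {K = X.K} {Y.K} K₁∌K₂))
        where
        K₁∌K₂ : Disjoint X.K Y.K
        K₁∌K₂ z Xz with Y.K z in Yz
        ... | false = refl
        ... | true  = ⊥-elim (true≢false Xz (K₂∌K₁ z Yz))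

      i₂ : i X.H′ Y.K ≡ i H₂ Y.K
      i₂ = trans iK₂ (trans Y.i-eq (sym (mix-i {K = Y.K} {X.H′} {Y.H′})))

      tK₂ : Tight X.H′ Y.K
      tK₂ = subst (λ k → 2 * card Y.K ≤ k + 2) (sym iK₂) Y.tight

      sparse₂ : Sparse H₂
      sparse₂ = mix-sparse {K = Y.K} {X.H′} {Y.H′} (sparse X.good) tK₂ (sparse Y.good)

      d-cases : ∀ w → d H₂ w ≡ d X.H′ w × Y.K w ≡ false ⊎ d H₂ w ≡ d Y.H′ w × Y.K w ≡ true
      d-cases = d-mix {K₁ = X.K} {Y.K} K₂∌K₁ {H} {X.H′} {Y.H′} X.agree Y.agree

      deg₂≤5 : ∀ w → d H₂ w ≤ 5
      deg₂≤5 w with d-cases w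
      ... | inj₁ (eq , _) = ≤-trans (≤-reflexive eq) (deg≤5 X.good w)
      ... | inj₂ (eq , _) = ≤-trans (≤-reflexive eq) (deg≤5 Y.good w)

      deg₂x : d H₂ x ≤ 4
      deg₂x with d-cases x
      ... | inj₁ (eq , _)  = ≤-trans (≤-reflexive eq) X.deg≤4
      ... | inj₂ (_ , Kx) = ⊥-elim (true≢false X.v∈K (K₂∌K₁ x Kx))

      deg₂y : d H₂ y ≤ 4
      deg₂y with d-cases y
      ... | inj₁ (_ , Ky) = ⊥-elim (true≢false Y.v∈K Ky)
      ... | inj₂ (eq , _)  = ≤-trans (≤-reflexive eq) Y.deg≤4

      fits₂ : Fits H₂
      fits₂ u v with m-mix {K₁ = X.K} {Y.K} K₂∌K₁ {H} {X.H′} {Y.H′} X.agree Y.agree u v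
      ... | inj₁ eq = ≤-trans (≤-reflexive eq) (fits X.good u v)
      ... | inj₂ eq = ≤-trans (≤-reflexive eq) (fits Y.good u v)

      xy∉H₂ : m H₂ x y ≡ 0
      xy∉H₂ = trans (sym (ag₂ _ (at-vanishes {K = Y.K} (cong (_∧ Y.K y) K₂x))))
             (trans (sym (X.agree _ (at-vanishes {K = X.K} (trans (cong (X.K x ∧_) (K₂∌K₁ y Y.v∈K)) (Bool.∧-zeroʳ (X.K x))))))
                    xy∉H)
        where
        K₂x : Y.K x ≡ false
        K₂x with Y.K x in eq
        ... | false = refl
        ... | true  = ⊥-elim (true≢false X.v∈K (K₂∌K₁ x eq))

      length₂ : length H₂ ≡ length H
      length₂ = sym (trans (agree-length {K = X.K} {H} {X.H′} X.agree X.i-eq)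
                           (agree-length {K = Y.K} {X.H′} {H₂} ag₂ i₂))

      fits-+xy : Fits ((x , y) ∷ H₂)
      fits-+xy = fits-∷ {H₂} fits₂ adj xy∉H₂

      deg-+xy : ∀ v → d ((x , y) ∷ H₂) v ≤ 5
      deg-+xy = deg≤5-∷ {H₂} x≢y deg₂≤5 deg₂x deg₂y

      module Shrink {W : VSet n} (around : TightAround H₂ x y W)
                    (least : ∀ Y → TightAround H₂ x y Y → W ⊆ᵛ Y) where

        -- `W` is tight in `H₂`, which differs from `H` inside `X.K` and `Y.K`. Uniting all three,
        -- which overlap in `x` and in `y`, gives a set that spans equally many edges in both and so
        -- is tight in `H`.
        L : VSet n
        L = W ∪ᵛ (X.K ∪ᵛ Y.K)

        W⊆L : W ⊆ᵛ L
        W⊆L v = ∪-introˡ W (X.K ∪ᵛ Y.K)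

        K₁⊆L : X.K ⊆ᵛ L
        K₁⊆L v p = ∪-introʳ W (X.K ∪ᵛ Y.K) (∪-introˡ X.K Y.K p)

        K₂⊆L : Y.K ⊆ᵛ L
        K₂⊆L v p = ∪-introʳ W (X.K ∪ᵛ Y.K) (∪-introʳ X.K Y.K p)

        iL : i H L ≡ i H₂ L
        iL = trans (agree-i {K = X.K} {L} {H} {X.H′} X.agree X.i-eq K₁⊆L)
                   (agree-i {K = Y.K} {L} {X.H′} {H₂} ag₂ i₂ K₂⊆L)

        tight₂L : Tight H₂ L
        tight₂L = tight-≗ {H = H₂} assoc
          (tight-∪ {H = H₂} sparse₂ {W ∪ᵛ X.K} {Y.K}
            (tight-∪ {H = H₂} sparse₂ {W} {X.K} (proj₂ (proj₂ around))
              (subst (λ k → 2 * card X.K ≤ k + 2) (trans X.i-eq (sym iK₁)) X.tight) {x} (proj₁ around) X.v∈K)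
            (subst (λ k → 2 * card Y.K ≤ k + 2) (trans (sym iK₂) i₂) Y.tight)
            {y} (∪-introˡ W X.K (proj₁ (proj₂ around))) Y.v∈K)
          where
          assoc : ((W ∪ᵛ X.K) ∪ᵛ Y.K) ≗ L
          assoc v = Bool.∨-assoc (W v) (X.K v) (Y.K v)

        tightL : Tight H L
        tightL = subst (λ k → 2 * card L ≤ k + 2) (sym iL) tight₂L

        S′ : VSet n
        S′ v = S v ∧ not (W v)

        L∌S′ : Disjoint L S′
        L∌S′ v Lv with W v
        ... | true  = Bool.∧-zeroʳ (S v)
        ... | false = trans (Bool.∧-identityʳ (S v)) ([ X.K∌S v , Y.K∌S v ]′ (∪-elim X.K Y.K Lv))

        -- If `W` missed `S`, then `L` would be a tight set of `H` outside `S` around `x` and `y`.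
        smaller : card S′ < card S
        smaller with Fin.any? (λ v → (S ∩ᵛ W) v Bool.≟ true)
        ... | yes (v , SWv) = sum-strict (λ u → truthTable 2 (λ a b → 𝟙 (a ∧ not b)) (λ a b → 𝟙 a) (S u) (W u)) v lt
          where
          lt : 𝟙 (S v ∧ not (W v)) < 𝟙 (S v)
          lt rewrite proj₁ (∧-true {S v} SWv) | proj₂ (∧-true {S v} SWv) = ≤-refl
        ... | no none = ⊥-elim (apart L away (K₁⊆L x X.v∈K , K₂⊆L y Y.v∈K , tightL))
          where
          away : Disjoint L S
          away v Lv with S v in eqS | W v in eqW
          ... | false | _     = refl
          ... | true  | true  = contradiction (v , cong₂ _∧_ eqS eqW) none
          ... | true  | false = ⊥-elim (true≢false eqS ([ X.K∌S v , Y.K∌S v ]′ (∪-elim X.K Y.K Lv)))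

        keep : ∀ v → S v ≡ false → Reducible H S′ v
        keep v Sv = record
          { K = R.K ; v∈K = R.v∈K ; K∌S = λ u p → cong (_∧ not (W u)) (R.K∌S u p) ; tight = R.tight
          ; H′ = R.H′ ; good = R.good ; deg≤4 = R.deg≤4 ; agree = R.agree ; i-eq = R.i-eq }
          where module R = Reducible (State.reducible st v Sv)

        -- A vertex of `S` in `W` is desaturated by exchanging an edge of `H₂` at it for `xy`. Both
        -- edges lie inside `L`, so the whole change from `H` is confined to `L`.
        new : ∀ v → S v ≡ true → W v ≡ true → Reducible H S′ v
        new v Sv Wv = swapped (exchange {H = H₂} sparse₂ around least Wv x≢v)
          where
          x≢v : x ≢ v
          x≢v refl = true≢false Sv Sx

          y≢v : y ≢ v
          y≢v refl = true≢false Sv Sy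

          Lxy : inside L (x , y) ≡ true
          Lxy = cong₂ _∧_ (K₁⊆L x X.v∈K) (K₂⊆L y Y.v∈K)

          swapped : (∃₂ λ f J → H₂ ↭ f ∷ J × inside W f ≡ true × 0 < inc v f × Sparse ((x , y) ∷ J)) →
            Reducible H S′ v
          swapped (f , J , p , Wf , v∈f , spJ) = record
            { K = L ; v∈K = W⊆L v Wv ; K∌S = L∌S′ ; tight = tightL
            ; H′ = (x , y) ∷ J
            ; good = record
              { sparse = spJ
              ; fits   = λ u w → ≤-trans (+-monoʳ-≤ (at u w (x , y)) (J≤ (at u w))) (fits-+xy u w)
              ; deg≤5  = λ w → ≤-trans (+-monoʳ-≤ (inc w (x , y)) (J≤ (inc w))) (deg-+xy w) }
            -- `v` lies in `S` while `x` and `y` do not, so `v` loses the end of `f` and gains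
            -- nothing.
            ; deg≤4 = ≤-trans (≤-reflexive (cong (_+ d J v) (cong₂ _+_ (δ-≢ x≢v) (δ-≢ y≢v))))
                (s≤s⁻¹ (≤-trans (+-monoˡ-≤ (d J v) v∈f) (≤-trans (≤-reflexive (sym (tot-↭ (inc v) p))) (deg₂≤5 v))))
            ; agree = λ g van → trans (X.agree g (λ e → van e ∘ inside-mono {K = X.K} {L} K₁⊆L e))
                (trans (ag₂ g (λ e → van e ∘ inside-mono {K = Y.K} {L} K₂⊆L e))
                (trans (tot-↭ g p) (cong (_+ tot g J) (trans (van f Lf) (sym (van (x , y) Lxy))))))
            ; i-eq = trans iL (trans (tot-↭ _ p) (cong (_+ i J L) (trans (cong 𝟙 Lf) (sym (cong 𝟙 Lxy)))))
            }
            where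
            J≤ : ∀ g → tot g J ≤ tot g H₂
            J≤ g = ≤-trans (m≤n+m _ (g f)) (≤-reflexive (sym (tot-↭ g p)))

            Lf : inside L f ≡ true
            Lf = inside-mono {K = W} {L} W⊆L f Wf

        shrunk : State H S′
        shrunk = record
          { saturated = λ v S′v → State.saturated st v (proj₁ (∧-true S′v))
          ; reducible = red }
          where
          red : ∀ v → S′ v ≡ false → Reducible H S′ v
          red v S′v with bool-cases (S v) | bool-cases (W v)
          ... | inj₂ Sv | _       = keep v Sv
          ... | inj₁ Sv | inj₁ Wv = new v Sv Wv
          ... | inj₁ Sv | inj₂ Wv = ⊥-elim (true≢false (cong₂ (λ a b → a ∧ not b) Sv Wv) S′v)

    step : (∃[ H⁺ ] (Good H⁺ × length H⁺ ≡ suc (length H))) ⊎ (∃[ S′ ] (card S′ < card S × State H S′))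
    step with sparse-or-tight {H = H₂} sparse₂ x y
    ... | inj₁ sp⁺ = inj₁ ((x , y) ∷ H₂ , record { sparse = sp⁺ ; fits = fits-+xy ; deg≤5 = deg-+xy } , cong suc length₂)
    ... | inj₂ t with W , around , least ← smallest-tight {H = H₂} sparse₂ t =
      inj₂ (Shrink.S′ around least , Shrink.smaller around least , Shrink.shrunk around least)

-- States in which no further exchange is possible

｛_｝ᵛ : Fin n → VSet n
｛ v ｝ᵛ u = does (v Fin.≟ u)

∈｛｝ : ∀ (v : Fin n) → ｛ v ｝ᵛ v ≡ true
∈｛｝ v = dec-true (v Fin.≟ v) refl

∈｛｝⇒≡ : ∀ {v u : Fin n} → ｛ v ｝ᵛ u ≡ true → v ≡ u
∈｛｝⇒≡ {v = v} {u} = does-true (v Fin.≟ u)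

tight-｛｝ : ∀ (H : List (Edge n)) v → Tight H ｛ v ｝ᵛ
tight-｛｝ H v = ≤-trans (≤-reflexive (cong (2 *_) (sum-δ₁ v))) (m≤n+m 2 (i H ｛ v ｝ᵛ))

disjoint? : ∀ (K S : VSet n) → Dec (Disjoint K S)
disjoint? K S = Fin.all? (λ v → (K v Bool.≟ true) →-dec (S v Bool.≟ false))

Covered : List (Edge n) → VSet n → Fin n → Fin n → Set
Covered H S x y = ∃[ K ] (Disjoint K S × TightAround H x y K)

covered? : ∀ (H : List (Edge n)) S x y → Dec (Covered H S x y)
covered? H S x y = findSet
  (λ eq (dis , t) → (λ v Yv → dis v (trans (eq v) Yv)) , tightAround-≗ {H = H} eq t)
  (λ K → disjoint? K S ×-dec tightAround? H x y K)

module _ (G : Multigraph n) where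

  Closed : List (Edge n) → VSet n → Set
  Closed H S = ∀ x y → S x ≡ false → S y ≡ false → 0 < mult G x y → 0 < m H x y ⊎ Covered H S x y

  Larger : List (Edge n) → Set
  Larger H = ∃[ H⁺ ] (Good G H⁺ × length H⁺ ≡ suc (length H))

  module _ {H : List (Edge n)} (good : Good G H) where

    private
      S₀ : VSet n
      S₀ v = does (5 ≤? d H v)

      start : State G H S₀
      start = record { saturated = sat ; reducible = red }
        where
        sat : ∀ v → S₀ v ≡ true → 5 ≤ d H v
        sat v h = does-true (5 ≤? d H v) h
        red : ∀ v → S₀ v ≡ false → Reducible G H S₀ v
        red v h = record
          -- An unsaturated vertex needs no change: its singleton is tight and `H` itself serves as
          -- `H′`.
          { K = ｛ v ｝ᵛ ; v∈K = ∈｛｝ v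
          ; K∌S = λ u p → subst (λ w → S₀ w ≡ false) (∈｛｝⇒≡ p) h
          ; tight = tight-｛｝ H v ; H′ = H ; good = good
          ; deg≤4 = ≤-pred (≰⇒> (does-false (5 ≤? d H v) h)) ; agree = λ _ _ → refl ; i-eq = refl }

      Violation : VSet n → Fin n → Fin n → Set
      Violation S x y = S x ≡ false × S y ≡ false × 0 < mult G x y × m H x y ≡ 0 × ¬ Covered H S x y

      violation? : ∀ S x y → Dec (Violation S x y)
      violation? S x y = (S x Bool.≟ false) ×-dec ((S y Bool.≟ false) ×-dec
        ((0 <? mult G x y) ×-dec ((m H x y ≟ 0) ×-dec ¬? (covered? H S x y))))

      loop : ∀ S → Acc _<_ (card S) → State G H S → Larger H ⊎ (∃[ S′ ] (State G H S′ × Closed H S′))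
      loop S (acc rs) st with Fin.any? (λ x → Fin.any? (violation? S x))
      ... | no none = inj₂ (S , st , closed)
        where
        closed : Closed H S
        closed x y Sx Sy adj with covered? H S x y | m H x y in eq
        ... | yes c | _     = inj₂ c
        ... | no ¬c | suc k = inj₁ z<s
        ... | no ¬c | zero  = contradiction (x , y , Sx , Sy , adj , eq , ¬c) none
      ... | yes (x , y , Sx , Sy , adj , xy∉H , ¬c)
        with Step.step G good st Sx Sy adj xy∉H (λ K dis t → ¬c (K , dis , t))
      ...   | inj₁ larger         = inj₁ larger
      ...   | inj₂ (S′ , l , st′) = loop S′ (rs l) st′

    larger-or-closed : Larger H ⊎ (∃[ S ] (State G H S × Closed H S))
    larger-or-closed = loop S₀ (<-wellFounded _) start

-- Labels of the maximal tight sets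

first : VSet n → Maybe (Fin n)
first {zero}  p = nothing
first {suc n} p with p zero
... | true  = just zero
... | false = Maybe.map suc (first (p ∘ suc))

first-≗ : {p q : VSet n} → p ≗ q → first p ≡ first q
first-≗ {zero}  eq = refl
first-≗ {suc n} {p} {q} eq with p zero | q zero | eq zero
... | true  | true  | _ = refl
... | false | false | _ = cong (Maybe.map suc) (first-≗ (eq ∘ suc))

first-just : (p : VSet n) → ∀ {v} → p v ≡ true → ∃[ u ] (first p ≡ just u × p u ≡ true)
first-just {suc n} p {v} h with p zero in eq
... | true  = zero , refl , eq
first-just {suc n} p {zero}  h | false = ⊥-elim (true≢false h eq)
first-just {suc n} p {suc v} h | false with u , fst , pu ← first-just (p ∘ suc) h =
  suc u , cong (Maybe.map suc) fst , pu

-- A partition of the complement of `S` is encoded by a labelling, its classes being the fibres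
-- outside `S`. Fibres may be empty.
cls : VSet n → (Fin n → Fin n) → Fin n → VSet n
cls S ℓ c v = not (S v) ∧ does (ℓ v Fin.≟ c)

-- 1 ⊓ card is the indicator of nonempty classes: these are tight.
TightLabelling : List (Edge n) → VSet n → (Fin n → Fin n) → Set
TightLabelling H S ℓ = ∀ c → 2 * card (cls S ℓ c) ≤ i H (cls S ℓ c) + 2 * (1 ⊓ card (cls S ℓ c))

module Labelling {H : List (Edge n)} (sp : Sparse H) (S : VSet n) where

  private
    -- Removing v from S makes the largest tight set exist for every v.
    Candidate : Fin n → VSet n → Set
    Candidate v K = K v ≡ true × Disjoint K (S -ᵛ v) × Tight H K

    candidate-≗ : ∀ v {X Y} → X ≗ Y → Candidate v X → Candidate v Y
    candidate-≗ v eq (Xv , dis , t) = trans (sym (eq v)) Xv , (λ u Yu → dis u (trans (eq u) Yu)) , tight-≗ {H = H} eq t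

    candidate? : ∀ v X → Dec (Candidate v X)
    candidate? v X = (X v Bool.≟ true) ×-dec (disjoint? X (S -ᵛ v) ×-dec tight? H X)

    not-involutive-≗ : ∀ (X : VSet n) → X ≗ not ∘ (not ∘ X)
    not-involutive-≗ X v = sym (Bool.not-involutive (X v))

    -- A largest candidate is found as the complement of a smallest set.
    largest : ∀ v → ∃[ W ] (Candidate v (not ∘ W) × ∀ Y → Candidate v (not ∘ Y) → card W ≤ card Y)
    largest v = smallest (λ eq → candidate-≗ v (cong not ∘ eq)) (λ X → candidate? v (not ∘ X)) (not ∘ ｛ v ｝ᵛ)
      (candidate-≗ v (not-involutive-≗ ｛ v ｝ᵛ) (∈｛｝ v , dis , tight-｛｝ H v))
      where
      dis : Disjoint ｛ v ｝ᵛ (S -ᵛ v)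
      dis u h with refl ← ∈｛｝⇒≡ {v = v} {u} h = trans (cong (λ b → S v ∧ not b) (∈｛｝ v)) (Bool.∧-zeroʳ (S v))

    M : Fin n → VSet n
    M v = not ∘ proj₁ (largest v)

    v∈M : ∀ v → M v v ≡ true
    v∈M v = proj₁ (proj₁ (proj₂ (largest v)))

    M-tight : ∀ v → Tight H (M v)
    M-tight v = proj₂ (proj₂ (proj₁ (proj₂ (largest v))))

    -ᵛ-∉ : ∀ {v} → S v ≡ false → ∀ u → (S -ᵛ v) u ≡ S u
    -ᵛ-∉ {v} Sv u with u Fin.≟ v
    ... | yes refl = trans (Bool.∧-zeroʳ (S v)) (sym Sv)
    ... | no _     = Bool.∧-identityʳ (S u)

    M∌S : ∀ {v} → S v ≡ false → Disjoint (M v) S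
    M∌S {v} Sv u Mu = trans (sym (-ᵛ-∉ Sv u)) (proj₁ (proj₂ (proj₁ (proj₂ (largest v)))) u Mu)

    -- `K` and `M v` share `z`, so their union is again a candidate. It would be larger than `M v`
    -- if `K` had a vertex outside.
    M-largest : ∀ {v z} → S v ≡ false → ∀ K → Disjoint K S → Tight H K → K z ≡ true → M v z ≡ true → K ⊆ᵛ M v
    M-largest {v} {z} Sv K dis tK Kz Mz u Ku with M v u in eq
    ... | true  = refl
    ... | false = contradiction
      (proj₂ (proj₂ (largest v)) (not ∘ (M v ∪ᵛ K)) (candidate-≗ v (not-involutive-≗ (M v ∪ᵛ K)) cand))
      (<⇒≱ (sum-strict (λ w → mono (proj₁ (largest v) w) (K w)) u strict))
      where
      cand : Candidate v (M v ∪ᵛ K)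
      cand = ∪-introˡ (M v) K (v∈M v)
        , (λ w p → trans (-ᵛ-∉ Sv w) ([ M∌S Sv w , dis w ]′ (∪-elim (M v) K p)))
        , tight-∪ {H = H} sp (M-tight v) tK Mz Kz
      mono = truthTable 2 (λ a b → 𝟙 (not (not a ∨ b))) (λ a b → 𝟙 a)
      strict : 𝟙 (not (M v u ∨ K u)) < 𝟙 (proj₁ (largest v) u)
      strict rewrite Ku | eq with proj₁ (largest v) u
      ... | true = ≤-refl

    M-≗ : ∀ {u v z} → S u ≡ false → S v ≡ false → M u z ≡ true → M v z ≡ true → M u ≗ M v
    M-≗ {u} {v} Su Sv Mu Mv w with M u w in equ | M v w in eqv
    ... | true  | true  = refl
    ... | false | false = refl
    ... | true  | false =
      ⊥-elim (true≢false (M-largest Sv (M u) (M∌S Su) (M-tight u) Mu Mv w equ) eqv)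
    ... | false | true =
      ⊥-elim (true≢false (M-largest Su (M v) (M∌S Sv) (M-tight v) Mv Mu w eqv) equ)

  -- A maximal tight set is named by its first element, which exists because `M v` contains `v`.
  ℓ : Fin n → Fin n
  ℓ v = fromMaybe v (first (M v))

  private
    ℓ∈M : ∀ v → M v (ℓ v) ≡ true
    ℓ∈M v with u , fst , Mu ← first-just (M v) (v∈M v) rewrite fst = Mu

    ℓ-≗ : ∀ u v → M u ≗ M v → ℓ u ≡ ℓ v
    ℓ-≗ u v eq with w , fst , _ ← first-just (M u) (v∈M u)
      rewrite trans (sym (first-≗ eq)) fst | fst = refl

  covered⇒≡ : ∀ {x y} → S x ≡ false → S y ≡ false → Covered H S x y → ℓ x ≡ ℓ y
  covered⇒≡ {x} {y} Sx Sy (K , dis , Kx , Ky , tK) =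
    ℓ-≗ x y (M-≗ Sx Sy (M-largest Sx K dis tK Kx (v∈M x) x Kx) (M-largest Sy K dis tK Ky (v∈M y) x Kx))

  -- A nonempty class is the maximal tight set of any of its vertices: two such sets with the same
  -- label share that label as a vertex and hence coincide.
  labelling-tight : TightLabelling H S ℓ
  labelling-tight c with Fin.any? (λ v → cls S ℓ c v Bool.≟ true)
  ... | no none = ≤-trans (≤-reflexive (cong (2 *_) (card-empty (cls S ℓ c) none))) z≤n
  ... | yes (v , h) =
    subst (λ k → 2 * card (cls S ℓ c) ≤ i H (cls S ℓ c) + 2 * k) (sym (m≤n⇒m⊓n≡m (card-positive (cls S ℓ c) h)))
      (tight-≗ {H = H} same (M-tight v))
    where
    Sv : S v ≡ false
    Sv = not-true (proj₁ (∧-true h))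
    label : ∀ {u} → does (ℓ u Fin.≟ c) ≡ true → ℓ u ≡ c
    label {u} = does-true (ℓ u Fin.≟ c)
    ℓv≡c : ℓ v ≡ c
    ℓv≡c = label (proj₂ (∧-true {not (S v)} h))
    same : M v ≗ cls S ℓ c
    same u with M v u in Mu | cls S ℓ c u in Cu
    ... | true  | true  = refl
    ... | false | false = refl
    ... | true  | false = ⊥-elim (true≢false (cong₂ _∧_ (cong not Su) (dec-true (ℓ u Fin.≟ c) ℓu≡c)) Cu)
      where
      Su : S u ≡ false
      Su = M∌S Sv u Mu
      ℓu≡c : ℓ u ≡ c
      ℓu≡c = trans (ℓ-≗ u v (M-≗ Su Sv (v∈M u) Mu)) ℓv≡c
    ... | false | true  = ⊥-elim (true≢false (trans (sym (M-≗ Su Sv ℓ∈Mu ℓ∈Mv u)) (v∈M u)) Mu)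
      where
      Su : S u ≡ false
      Su = not-true (proj₁ (∧-true Cu))
      ℓ∈Mu : M u c ≡ true
      ℓ∈Mu = subst (λ w → M u w ≡ true) (label (proj₂ (∧-true {not (S u)} Cu))) (ℓ∈M u)
      ℓ∈Mv : M v c ≡ true
      ℓ∈Mv = subst (λ w → M v w ≡ true) ℓv≡c (ℓ∈M v)

-- Counting labels and crossing edges

labels : VSet n → (Fin n → Fin n) → ℕ
labels S ℓ = sum (λ c → 1 ⊓ card (cls S ℓ c))

cross : VSet n → (Fin n → Fin n) → Fin n → Fin n → Bool
cross S ℓ u v = not (S u) ∧ not (S v) ∧ not (does (ℓ u Fin.≟ ℓ v))

module _ (G : Multigraph n) where

  -- Parallel edges count once, since a closed `H` is only known to contain one copy of each
  -- crossing pair.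
  link : VSet n → (Fin n → Fin n) → Fin n → Fin n → Bool
  link S ℓ u v = does (0 <? mult G u v) ∧ cross S ℓ u v

  -- Ordered pairs: every crossing edge is counted twice.
  links : VSet n → (Fin n → Fin n) → ℕ
  links S ℓ = sum (λ u → sum (λ v → 𝟙 (link S ℓ u v)))

cross-sym : ∀ S (ℓ : Fin n → Fin n) u v → cross S ℓ u v ≡ cross S ℓ v u
cross-sym S ℓ u v with S u | S v
... | true  | true  = refl
... | true  | false = refl
... | false | true  = refl
... | false | false with ℓ u Fin.≟ ℓ v | ℓ v Fin.≟ ℓ u
...   | yes _ | yes _ = refl
...   | no _  | no _  = refl
...   | yes p | no ¬q = contradiction (sym p) ¬q
...   | no ¬p | yes q = contradiction (sym q) ¬p

sum-at : ∀ (g : Fin n → Fin n → ℕ) a b → sum (λ u → sum (λ v → at u v (a , b) * g u v)) ≡ g a b + g b a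
sum-at g a b = trans (sum-cong-≗ inner)
  (trans (∑-distrib-+ (λ u → δ a u * g u b) (λ u → δ b u * g u a)) (cong₂ _+_ (sum-δ a (λ u → g u b)) (sum-δ b (λ u → g u a))))
  where
  eq : ∀ p q r s t → (p * q + r * s) * t ≡ q * (p * t) + r * (s * t)
  eq = solve-∀
  inner : ∀ u → sum (λ v → at u v (a , b) * g u v) ≡ δ a u * g u b + δ b u * g u a
  inner u = trans (sum-cong-≗ (λ v → eq (δ a u) (δ b v) (δ a v) (δ b u) (g u v)))
    (trans (∑-distrib-+ (λ v → δ b v * (δ a u * g u v)) (λ v → δ a v * (δ b u * g u v)))
           (cong₂ _+_ (sum-δ b (λ v → δ a u * g u v)) (sum-δ a (λ v → δ b u * g u v))))

tot-*ʳ : ∀ {A : Set} (g : A → ℕ) H k → tot g H * k ≡ tot (λ e → g e * k) H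
tot-*ʳ g []      k = refl
tot-*ʳ g (e ∷ H) k = trans (*-distribʳ-+ k (g e) (tot g H)) (cong (g e * k +_) (tot-*ʳ g H k))

tot-*ˡ : ∀ {A : Set} k (g : A → ℕ) H → k * tot g H ≡ tot (λ e → k * g e) H
tot-*ˡ k g H = trans (*-comm k (tot g H)) (trans (tot-*ʳ g H k) (tot-cong (λ e → *-comm (g e) k) H))

-- Double counting: each edge contributes at both orders of its ends, and `g` is symmetric.
sum-m : ∀ (H : List (Edge n)) (g : Fin n → Fin n → ℕ) → (∀ u v → g u v ≡ g v u) →
  sum (λ u → sum (λ v → m H u v * g u v)) ≡ 2 * tot (λ (a , b) → g a b) H
sum-m {n} H g g-sym =
  trans (sum-cong-≗ (λ u → trans (sum-cong-≗ (λ v → tot-*ʳ (at u v) H (g u v))) (sum-tot (λ v e → at u v e * g u v) H)))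
 (trans (sum-tot (λ u e → sum (λ v → at u v e * g u v)) H)
 (trans (tot-cong (λ (a , b) → trans (sum-at g a b) (cong (g a b +_) (trans (g-sym b a) (sym (+-identityʳ (g a b)))))) H)
        (sym (tot-*ˡ 2 (λ (a , b) → g a b) H))))

-- The handshake lemma with vertex weights.
sum-d : ∀ (H : List (Edge n)) (g : Fin n → ℕ) → sum (λ v → d H v * g v) ≡ tot (λ (a , b) → g a + g b) H
sum-d H g = trans (sum-cong-≗ (λ v → tot-*ʳ (inc v) H (g v)))
  (trans (sum-tot (λ v e → inc v e * g v) H) (tot-cong (λ (a , b) → inner a b) H))
  where
  inner : ∀ a b → sum (λ v → inc v (a , b) * g v) ≡ g a + g b
  inner a b = trans (sum-cong-≗ (λ v → *-distribʳ-+ (g v) (δ a v) (δ b v)))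
    (trans (∑-distrib-+ (λ v → δ a v * g v) (λ v → δ b v * g v)) (cong₂ _+_ (sum-δ a g) (sum-δ b g)))

card-not : ∀ (S : VSet n) → card (not ∘ S) + card S ≡ n
card-not {n} S = trans (sym (∑-distrib-+ (𝟙 ∘ not ∘ S) (𝟙 ∘ S)))
  (trans (sum-cong-≗ (λ v → eq (S v))) (sum-1 n))
  where
  eq : ∀ b → 𝟙 (not b) + 𝟙 b ≡ 1
  eq true  = refl
  eq false = refl

sum-cls : ∀ (S : VSet n) ℓ → sum (λ c → card (cls S ℓ c)) ≡ card (not ∘ S)
sum-cls S ℓ = trans (∑-comm (λ c v → 𝟙 (cls S ℓ c v)))
  (sum-cong-≗ (λ v → trans (sum-cong-≗ (λ c → eq (not (S v)) (does (ℓ v Fin.≟ c)))) (sum-δ (ℓ v) (λ _ → 𝟙 (not (S v))))))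
  where
  eq : ∀ a b → 𝟙 (a ∧ b) ≡ 𝟙 b * 𝟙 a
  eq true  true  = refl
  eq true  false = refl
  eq false true  = refl
  eq false false = refl

i≤2card : ∀ {H : List (Edge n)} → Sparse H → ∀ X → i H X ≤ 2 * card X
i≤2card {H = H} sp X with Fin.any? (λ v → X v Bool.≟ true)
... | yes (v , Xv) = ≤-trans (m≤m+n _ 2) (sp X v Xv)
... | no none = ≤-trans (≤-reflexive (tot-zero empty H)) z≤n
  where
  empty : ∀ e → 𝟙 (inside X e) ≡ 0
  empty (a , b) with X a in eq
  ... | true  = contradiction (a , eq) none
  ... | false = refl

-- Counting the edges of a closed state

module _ (G : Multigraph n) {H : List (Edge n)} {S : VSet n} (sp : Sparse H) (short : length H + 3 ≤ 2 * n)
         (saturated : ∀ v → S v ≡ true → 5 ≤ d H v) {ℓ : Fin n → Fin n} (tight : TightLabelling H S ℓ)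
         (closed : ∀ x y → S x ≡ false → S y ≡ false → 0 < mult G x y → 0 < m H x y ⊎ ℓ x ≡ ℓ y) where

  private
    -- Edges of `H` between classes, edges meeting `S`, and edges inside classes.
    e = tot (λ (a , b) → 𝟙 (cross S ℓ a b)) H
    t = tot (λ (a , b) → 𝟙 (S a ∨ S b)) H
    c = sum (λ c → i H (cls S ℓ c))

    links≤ : links G S ℓ ≤ 2 * e
    links≤ = ≤-trans (sum-mono (λ u → sum-mono (λ v → le u v)))
      (≤-reflexive (sum-m H (λ u v → 𝟙 (cross S ℓ u v)) (λ u v → cong 𝟙 (cross-sym S ℓ u v))))
      where
      le : ∀ u v → 𝟙 (link G S ℓ u v) ≤ m H u v * 𝟙 (cross S ℓ u v)
      le u v with link G S ℓ u v in eq
      ... | false = z≤n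
      ... | true with adj , cr ← ∧-true {does (0 <? mult G u v)} {cross S ℓ u v} eq
            with Su , rest ← ∧-true {not (S u)} {not (S v) ∧ not (does (ℓ u Fin.≟ ℓ v))} cr
            with Sv , ≢ ← ∧-true {not (S v)} {not (does (ℓ u Fin.≟ ℓ v))} rest
            with closed u v (not-true Su) (not-true Sv) (does-true (0 <? mult G u v) adj)
      ... | inj₁ pos  = subst (λ b → 1 ≤ m H u v * 𝟙 b) (sym cr) (≤-trans pos (≤-reflexive (sym (*-identityʳ _))))
      ... | inj₂ same = contradiction same (does-false (ℓ u Fin.≟ ℓ v) (not-true ≢))

    -- The three kinds exclude each other, and an edge lies inside at most one class.
    partition : c + e + t ≤ length H
    partition =
      ≤-trans (≤-reflexive (trans (cong (λ k → k + e + t) (sum-tot (λ c → 𝟙 ∘ inside (cls S ℓ c)) H))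
        (trans (cong (_+ t) (sym (tot-+ _ _ H))) (sym (tot-+ _ _ H)))))
     (≤-trans (tot-mono (λ (a , b) → le a b) H) (≤-reflexive (tot-1 H)))
      where
      same : Fin n → Fin n → Bool
      same a b = does (ℓ a Fin.≟ ℓ b)
      le′ : ∀ a b c → 𝟙 (inside (cls S ℓ c) (a , b)) ≤ δ (ℓ a) c * 𝟙 (not (S a) ∧ not (S b) ∧ same a b)
      le′ a b c with S a | S b
      ... | true  | _     = z≤n
      ... | false | true  with ℓ a Fin.≟ c
      ...   | yes _ = z≤n
      ...   | no _  = z≤n
      le′ a b c | false | false with ℓ a Fin.≟ c | ℓ b Fin.≟ c | ℓ a Fin.≟ ℓ b
      ...   | yes _ | yes _ | yes _ = ≤-refl
      ...   | yes p | yes q | no ¬r = contradiction (trans p (sym q)) ¬r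
      ...   | yes _ | no _  | _     = z≤n
      ...   | no _  | _     | _     = z≤n
      le : ∀ a b → sum (λ c → 𝟙 (inside (cls S ℓ c) (a , b))) + 𝟙 (cross S ℓ a b) + 𝟙 (S a ∨ S b) ≤ 1
      le a b = ≤-trans
        (+-monoˡ-≤ (𝟙 (S a ∨ S b)) (+-monoˡ-≤ (𝟙 (cross S ℓ a b))
          (≤-trans (sum-mono (le′ a b)) (≤-reflexive (sum-δ (ℓ a) _)))))
        (truthTable 3 (λ x y z → 𝟙 (not x ∧ not y ∧ z) + 𝟙 (not x ∧ not y ∧ not z) + 𝟙 (x ∨ y)) (λ _ _ _ → 1)
           (S a) (S b) (same a b))

    -- The degrees in `S` add up to at least 5|S|. This sum counts the edges inside `S` once more
    -- than `t` does, and by sparsity there are at most 2|S| of those.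
    degrees : 3 * card S ≤ t
    degrees = cancel-≤ (+-mono-≤ (+-mono-≤ low ends) (i≤2card {H = H} sp S))
      (≤-reflexive (eq (card S) t (i H S) (sum (λ v → d H v * 𝟙 (S v)))))
      where
      low : 5 * card S ≤ sum (λ v → d H v * 𝟙 (S v))
      low = ≤-trans (≤-reflexive (sym (sum-* 5 (𝟙 ∘ S)))) (sum-mono le)
        where
        le : ∀ v → 5 * 𝟙 (S v) ≤ d H v * 𝟙 (S v)
        le v with S v in eq
        ... | true  = *-monoˡ-≤ 1 (saturated v eq)
        ... | false = z≤n
      ends : sum (λ v → d H v * 𝟙 (S v)) ≤ t + i H S
      ends = ≤-trans (≤-reflexive (sum-d H (𝟙 ∘ S)))
        (≤-trans (tot-mono (λ (a , b) → truthTable 2 (λ x y → 𝟙 x + 𝟙 y) (λ x y → 𝟙 (x ∨ y) + 𝟙 (x ∧ y)) (S a) (S b)) H)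
                 (≤-reflexive (tot-+ _ _ H)))
      eq : ∀ s t k D → 3 * s + (D + (t + k) + 2 * s) ≡ t + (5 * s + D + k)
      eq = solve-∀

    classes : 2 * card (not ∘ S) ≤ c + 2 * labels S ℓ
    classes =
      ≤-trans (≤-reflexive (trans (cong (2 *_) (sym (sum-cls S ℓ))) (sym (sum-* 2 (λ c → card (cls S ℓ c))))))
     (≤-trans (sum-mono tight)
     (≤-reflexive (trans (∑-distrib-+ (λ c → i H (cls S ℓ c)) (λ c → 2 * (1 ⊓ card (cls S ℓ c))))
        (cong (c +_) (sum-* 2 (λ c → 1 ⊓ card (cls S ℓ c)))))))

  -- With p labels, tightness gives c ≥ 2(n - |S|) - 2p. Since t ≥ 3|S| and c + e + t ≤ 2n - 3, it
  -- follows that 2p ≥ |S| + e + 3, which is doubled here because `links` counts ordered pairs.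
  many-labels : links G S ℓ + 2 * card S + 6 ≤ 4 * labels S ℓ
  many-labels = cancel-≤
    (+-mono-≤ links≤ (*-monoʳ-≤ 2 (+-mono-≤ (+-mono-≤ (+-mono-≤ classes partition) degrees)
       (subst (λ k → length H + 3 ≤ 2 * k) (sym (card-not S)) short))))
    (≤-reflexive (eq (links G S ℓ) (card S) (labels S ℓ) e t c (length H) (card (not ∘ S))))
    where
    eq : ∀ L s p e t c k N →
      L + 2 * s + 6 + (2 * e + 2 * (c + 2 * p + k + t + 2 * (N + s)))
      ≡ 4 * p + (L + 2 * (2 * N + (c + e + t) + 3 * s + (k + 3)))
    eq = solve-∀

-- Moving vertices into the deleted set

infixl 7 _+ᵛ_

_+ᵛ_ : ∀ {n} → VSet n → Fin n → VSet n
(S +ᵛ y) v = S v ∨ does (v Fin.≟ y)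

module _ {n} (S : VSet n) {y : Fin n} where

  +ᵛ-∈ : (S +ᵛ y) y ≡ true
  +ᵛ-∈ = trans (cong (S y ∨_) (dec-true (y Fin.≟ y) refl)) (Bool.∨-zeroʳ (S y))

  +ᵛ-mono : ∀ {v} → S v ≡ true → (S +ᵛ y) v ≡ true
  +ᵛ-mono Sv = cong (_∨ _) Sv

  +ᵛ-∉ : ∀ {v} → S v ≡ false → v ≢ y → (S +ᵛ y) v ≡ false
  +ᵛ-∉ {v} Sv v≢y = cong₂ _∨_ Sv (dec-false (v Fin.≟ y) v≢y)

  +ᵛ-∉⁻ : ∀ {v} → (S +ᵛ y) v ≡ false → S v ≡ false × v ≢ y
  +ᵛ-∉⁻ {v} h with S v | v Fin.≟ y
  ... | false | no v≢y = refl , v≢y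

  card-+ᵛ : S y ≡ false → card (S +ᵛ y) ≡ suc (card S)
  card-+ᵛ Sy = trans (card-remove (S +ᵛ y) +ᵛ-∈) (cong suc (card-≗ same))
    where
    same : (S +ᵛ y) -ᵛ y ≗ S
    same v with v Fin.≟ y
    ... | yes refl rewrite Sy = refl
    ... | no _ = trans (Bool.∧-identityʳ _) (Bool.∨-identityʳ _)

  card-not-+ᵛ : S y ≡ false → card (not ∘ (S +ᵛ y)) < card (not ∘ S)
  card-not-+ᵛ Sy = sum-strict
    (λ v → truthTable 2 (λ a b → 𝟙 (not (a ∨ b))) (λ a b → 𝟙 (not a)) (S v) (does (v Fin.≟ y))) y strict
    where
    strict : 𝟙 (not ((S +ᵛ y) y)) < 𝟙 (not (S y))
    strict rewrite +ᵛ-∈ | Sy = ≤-refl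

module _ {n} (G : Multigraph n) (ℓ : Fin n → Fin n) where

  Isolated : VSet n → Fin n → Set
  Isolated S v = S v ≡ false × (∀ u → 0 < mult G v u → S u ≡ true)

  isolated? : ∀ S v → Dec (Isolated S v)
  isolated? S v = (S v Bool.≟ false) ×-dec Fin.all? (λ u → (0 <? mult G v u) →-dec (S u Bool.≟ true))

  isos : VSet n → ℕ
  isos S = sum (λ v → 𝟙 (does (isolated? S v)))

  private
    Link : VSet n → Fin n → Fin n → Set
    Link S u v = link G S ℓ u v ≡ true

    link-intro : ∀ {S u v} → 0 < mult G u v → S u ≡ false → S v ≡ false → ℓ u ≢ ℓ v → Link S u v
    link-intro {S} {u} {v} adj Su Sv ≢ =
      cong₂ _∧_ (dec-true (0 <? mult G u v) adj)
        (cong₂ _∧_ (cong not Su) (cong₂ _∧_ (cong not Sv) (cong not (dec-false (ℓ u Fin.≟ ℓ v) ≢))))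

    link-elim : ∀ {S u v} → Link S u v → 0 < mult G u v × S u ≡ false × S v ≡ false × ℓ u ≢ ℓ v
    link-elim {S} {u} {v} h =
      let adj , cr = ∧-true {does (0 <? mult G u v)} {cross S ℓ u v} h
          Su , r   = ∧-true {not (S u)} {not (S v) ∧ not (does (ℓ u Fin.≟ ℓ v))} cr
          Sv , ≢   = ∧-true {not (S v)} {not (does (ℓ u Fin.≟ ℓ v))} r
      in does-true (0 <? mult G u v) adj , not-true Su , not-true Sv , does-false (ℓ u Fin.≟ ℓ v) (not-true ≢)

    link-sym : ∀ S u v → link G S ℓ u v ≡ link G S ℓ v u
    link-sym S u v = cong₂ _∧_ (cong (λ k → does (0 <? k)) (mult-sym G u v)) (cross-sym S ℓ u v)

    link-irrefl : ∀ S u → link G S ℓ u u ≡ false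
    link-irrefl S u with link G S ℓ u u in eq
    ... | false = refl
    ... | true  = contradiction refl (proj₂ (proj₂ (proj₂ (link-elim {S} eq))))

    linkDeg : VSet n → Fin n → ℕ
    linkDeg S u = sum (λ v → 𝟙 (link G S ℓ u v))

    -- The class of such an `x` survives when `x` moves into `S`.
    Shared : VSet n → Fin n → Set
    Shared S x = ∃[ z ] (z ≢ x × S z ≡ false × ℓ z ≡ ℓ x)

    shared? : ∀ S x → Dec (Shared S x)
    shared? S x = Fin.any? (λ z → ¬? (z Fin.≟ x) ×-dec ((S z Bool.≟ false) ×-dec (ℓ z Fin.≟ ℓ x)))

    -- Everything is doubled to match links; k is the slack.
    Bound : VSet n → ℕ → Set
    Bound S k = 4 * labels S ℓ + 6 * isos S + k ≤ 2 * card S + 4 + links G S ℓ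

    linkDeg-positive : ∀ {S x y} → Link S x y → 1 ≤ linkDeg S x
    linkDeg-positive {S} {x} {y} h = ≤-trans (≤-reflexive (cong 𝟙 (sym h))) (sum-≥ (λ v → 𝟙 (link G S ℓ x v)) y)

    link-+ᵛ : ∀ S x y v → v ≢ y → x ≢ y → link G (S +ᵛ y) ℓ x v ≡ link G S ℓ x v
    link-+ᵛ S x y v v≢y x≢y rewrite dec-false (v Fin.≟ y) v≢y | dec-false (x Fin.≟ y) x≢y
      | Bool.∨-identityʳ (S x) | Bool.∨-identityʳ (S v) = refl

    link-+ᵛ-≤ : ∀ S y u v → 𝟙 (link G (S +ᵛ y) ℓ u v) ≤ 𝟙 (link G S ℓ u v)
    link-+ᵛ-≤ S y u v = truthTable 6
      (λ a b c d e f → 𝟙 (a ∧ not (b ∨ e) ∧ not (c ∨ f) ∧ not d)) (λ a b c d e f → 𝟙 (a ∧ not b ∧ not c ∧ not d))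
      (does (0 <? mult G u v)) (S u) (S v) (does (ℓ u Fin.≟ ℓ v)) (does (u Fin.≟ y)) (does (v Fin.≟ y))

    link-+ᵛ-∈ʳ : ∀ S y u → link G (S +ᵛ y) ℓ u y ≡ false
    link-+ᵛ-∈ʳ S y u with link G (S +ᵛ y) ℓ u y in eq
    ... | false = refl
    ... | true  = ⊥-elim (true≢false (+ᵛ-∈ S) (proj₁ (proj₂ (proj₂ (link-elim {S +ᵛ y} eq)))))

    link-+ᵛ-∈ˡ : ∀ S y u → link G (S +ᵛ y) ℓ y u ≡ false
    link-+ᵛ-∈ˡ S y u = trans (link-sym (S +ᵛ y) y u) (link-+ᵛ-∈ʳ S y u)

    -- The links at `y` disappear, each of them as two ordered pairs.
    links-+ᵛ : ∀ S y → links G (S +ᵛ y) ℓ + 2 * linkDeg S y ≤ links G S ℓ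
    links-+ᵛ S y = ≤-trans (≤-reflexive (sym total)) (sum-mono (λ u → sum-mono (le u)))
      where
      f : Fin n → Fin n → ℕ
      f u v = 𝟙 (link G (S +ᵛ y) ℓ u v) + (δ y u * 𝟙 (link G S ℓ y v) + δ y v * 𝟙 (link G S ℓ y u))
      total : sum (λ u → sum (f u)) ≡ links G (S +ᵛ y) ℓ + 2 * linkDeg S y
      total =
        trans (sum-cong-≗ (λ u → trans (∑-distrib-+ (λ v → 𝟙 (link G (S +ᵛ y) ℓ u v)) _)
          (cong (sum (λ v → 𝟙 (link G (S +ᵛ y) ℓ u v)) +_)
            (trans (∑-distrib-+ (λ v → δ y u * 𝟙 (link G S ℓ y v)) _)
              (cong₂ _+_ (sum-* (δ y u) (λ v → 𝟙 (link G S ℓ y v))) (sum-δ y (λ _ → 𝟙 (link G S ℓ y u))))))))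
       (trans (∑-distrib-+ (λ u → sum (λ v → 𝟙 (link G (S +ᵛ y) ℓ u v))) _)
         (cong (links G (S +ᵛ y) ℓ +_)
           (trans (∑-distrib-+ (λ u → δ y u * linkDeg S y) _)
             (cong₂ _+_ (sum-δ y (λ _ → linkDeg S y)) (sym (+-identityʳ (linkDeg S y)))))))
      le : ∀ u v → f u v ≤ 𝟙 (link G S ℓ u v)
      le u v with y Fin.≟ u | y Fin.≟ v
      ... | yes refl | yes refl rewrite link-irrefl S y | link-irrefl (S +ᵛ y) y = z≤n
      ... | yes refl | no _ rewrite link-+ᵛ-∈ˡ S y v | +-identityʳ (𝟙 (link G S ℓ y v))
                                   | +-identityʳ (𝟙 (link G S ℓ y v)) = ≤-refl
      ... | no _ | yes refl rewrite link-+ᵛ-∈ʳ S y u | +-identityʳ (𝟙 (link G S ℓ y u)) =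
        ≤-reflexive (cong 𝟙 (link-sym S y u))
      ... | no _ | no _ rewrite +-identityʳ (𝟙 (link G (S +ᵛ y) ℓ u v)) = link-+ᵛ-≤ S y u v

    cls-+ᵛ : ∀ S y c → ℓ y ≢ c → cls S ℓ c ≗ cls (S +ᵛ y) ℓ c
    cls-+ᵛ S y c ≢ v with v Fin.≟ y
    ... | no _ rewrite Bool.∨-identityʳ (S v) = refl
    ... | yes refl rewrite dec-false (ℓ y Fin.≟ c) ≢ = trans (Bool.∧-zeroʳ _) (sym (Bool.∧-zeroʳ _))

    labels-+ᵛ : ∀ S y → labels S ℓ ≤ labels (S +ᵛ y) ℓ + 1
    labels-+ᵛ S y = ≤-trans (sum-mono le)
      (≤-reflexive (trans (∑-distrib-+ (λ c → 1 ⊓ card (cls (S +ᵛ y) ℓ c)) (δ (ℓ y)))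
                          (cong (labels (S +ᵛ y) ℓ +_) (sum-δ₁ (ℓ y)))))
      where
      le : ∀ c → 1 ⊓ card (cls S ℓ c) ≤ 1 ⊓ card (cls (S +ᵛ y) ℓ c) + δ (ℓ y) c
      le c with ℓ y Fin.≟ c
      ... | yes _ = ≤-trans (m⊓n≤m 1 _) (m≤n+m 1 _)
      ... | no ≢  = ≤-trans (≤-reflexive (cong (1 ⊓_) (card-≗ (cls-+ᵛ S y c ≢)))) (m≤m+n _ 0)

    labels-shared : ∀ S y → Shared S y → labels S ℓ ≤ labels (S +ᵛ y) ℓ + 0
    labels-shared S y (z , z≢y , Sz , eq) = ≤-trans (sum-mono le) (≤-reflexive (sym (+-identityʳ _)))
      where
      le : ∀ c → 1 ⊓ card (cls S ℓ c) ≤ 1 ⊓ card (cls (S +ᵛ y) ℓ c)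
      le c with ℓ y Fin.≟ c
      ... | no ≢  = ≤-reflexive (cong (1 ⊓_) (card-≗ (cls-+ᵛ S y c ≢)))
      ... | yes p = ≤-trans (m⊓n≤m 1 _) (≤-reflexive (sym (m≤n⇒m⊓n≡m
        (card-positive (cls (S +ᵛ y) ℓ c)
          (cong₂ _∧_ (cong not (+ᵛ-∉ S Sz z≢y)) (dec-true (ℓ z Fin.≟ c) (trans eq p)))))))

    -- `y` has the neighbour `x` outside `S`, so it is not isolated itself, and the isolated
    -- vertices remain isolated.
    isolated-+ᵛ : ∀ S y x v → Link S y x → 𝟙 (does (isolated? S v)) ≤ 𝟙 (does (isolated? (S +ᵛ y) v))
    isolated-+ᵛ S y x v h = 𝟙-does-mono (isolated? S v) (isolated? (S +ᵛ y) v)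
      (λ (Sv , nb) → +ᵛ-∉ S Sv (v≢y nb) , λ u → +ᵛ-mono S ∘ nb u)
      where
      v≢y : (∀ u → 0 < mult G v u → S u ≡ true) → v ≢ y
      v≢y nb refl = let adj , _ , Sx , _ = link-elim {S} h in true≢false (nb x adj) Sx

    isos-+ᵛ : ∀ S y x → Link S y x → isos S + 0 ≤ isos (S +ᵛ y)
    isos-+ᵛ S y x h = ≤-trans (≤-reflexive (+-identityʳ _)) (sum-mono (λ v → isolated-+ᵛ S y x v h))

    isos-new : ∀ S y x → Link S y x → ¬ Isolated S x → Isolated (S +ᵛ y) x → isos S + 1 ≤ isos (S +ᵛ y)
    isos-new S y x h ¬is is = ≤-trans (≤-reflexive (+-comm (isos S) 1))
      (sum-strict (λ v → isolated-+ᵛ S y x v h) x (𝟙-does-strict (isolated? S x) (isolated? (S +ᵛ y) x) ¬is is))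

    -- The balance of moving `y` into `S`: 2 is paid for |S| and 4 for each of the `s` labels lost;
    -- 6 is gained for each of the `j` new isolated vertices and 2 for each link at `y`.
    delete : ∀ S y → S y ≡ false → ∀ {s j k k′} →
      labels S ℓ ≤ labels (S +ᵛ y) ℓ + s → isos S + j ≤ isos (S +ᵛ y) →
      k + 2 + 4 * s ≤ k′ + 6 * j + 2 * linkDeg S y → Bound (S +ᵛ y) k′ → Bound S k
    delete S y Sy {s} {j} {k} {k′} ls is arith b = cancel-≤
      (+-mono-≤ (+-mono-≤ (+-mono-≤ (*-monoʳ-≤ 4 ls) (*-monoʳ-≤ 6 is)) (+-mono-≤ arith (links-+ᵛ S y)))
                (subst (λ c → 4 * labels (S +ᵛ y) ℓ + 6 * isos (S +ᵛ y) + k′ ≤ 2 * c + 4 + links G (S +ᵛ y) ℓ)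
                       (card-+ᵛ S Sy) b))
      (≤-reflexive (eq (labels S ℓ) (labels (S +ᵛ y) ℓ) (isos S) (isos (S +ᵛ y)) (card S)
                       (links G S ℓ) (links G (S +ᵛ y) ℓ) (linkDeg S y) s j k k′))
      where
      eq : ∀ l l′ o o′ c e e′ D s j k k′ →
        4 * l + 6 * o + k + (4 * (l′ + s) + 6 * o′ + (k′ + 6 * j + 2 * D + e) + (2 * suc c + 4 + e′))
        ≡ 2 * c + 4 + e + (4 * l + 6 * (o + j) + (k + 2 + 4 * s + (e′ + 2 * D)) + (4 * l′ + 6 * o′ + k′))
      eq = solve-∀

    -- `x` is a class of its own whose only link goes to `y`, so moving `y` isolates `x`. The gain
    -- of at least 6 + 2 against the cost 2 + 4 leaves a slack of 2.
    pendant : ∀ S x y → ¬ Shared S x → linkDeg S x ≤ 1 → Link S x y → Bound (S +ᵛ y) 0 → Bound S 2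
    pendant S x y single ≤1 h b =
      delete S y Sy {s = 1} {j = 1} (labels-+ᵛ S y) (isos-new S y x h′ ¬is is)
        (+-monoʳ-≤ 6 (*-monoʳ-≤ 2 (linkDeg-positive {S} h′))) b
      where
      h′ : Link S y x
      h′ = trans (link-sym S y x) h
      adj = proj₁ (link-elim {S} h)
      Sx = proj₁ (proj₂ (link-elim {S} h))
      Sy = proj₁ (proj₂ (proj₂ (link-elim {S} h)))
      ¬is : ¬ Isolated S x
      ¬is (_ , nb) = true≢false (nb y adj) Sy
      is : Isolated (S +ᵛ y) x
      is = +ᵛ-∉ S Sx (adjacent-≢ G adj) , nb
        where
        nb : ∀ u → 0 < mult G x u → (S +ᵛ y) u ≡ true
        nb u adju with u Fin.≟ y | S u in Su
        ... | _      | true  = refl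
        ... | yes _  | false = refl
        -- Another neighbour `u` outside `S` would have a different label, as `x` is alone in its
        -- class, and would give a second link.
        ... | no u≢y | false = contradiction ≤1 (<⇒≱ two)
          where
          hu : Link S x u
          hu = link-intro {S} adju Sx Su (λ eq → single (u , (adjacent-≢ G adju ∘ sym) , Su , sym eq))
          two : 2 ≤ linkDeg S x
          two = ≤-trans (≤-reflexive (sym (trans (∑-distrib-+ (δ y) (δ u)) (cong₂ _+_ (sum-δ₁ y) (sum-δ₁ u))))) (sum-mono le)
            where
            le : ∀ v → δ y v + δ u v ≤ 𝟙 (link G S ℓ x v)
            le v with y Fin.≟ v | u Fin.≟ v
            ... | yes refl | yes refl = contradiction refl u≢y
            ... | yes refl | no _ = ≤-reflexive (cong 𝟙 (sym h))
            ... | no _ | yes refl = ≤-reflexive (cong 𝟙 (sym hu))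
            ... | no _ | no _     = z≤n

    linkDeg-+ᵛ : ∀ S x y → Link S x y → linkDeg (S +ᵛ y) x + 1 ≡ linkDeg S x
    linkDeg-+ᵛ S x y h =
      trans (cong (linkDeg (S +ᵛ y) x +_) (sym (sum-δ₁ y)))
     (trans (sym (∑-distrib-+ (λ v → 𝟙 (link G (S +ᵛ y) ℓ x v)) (δ y))) (sum-cong-≗ eq))
      where
      eq : ∀ v → 𝟙 (link G (S +ᵛ y) ℓ x v) + δ y v ≡ 𝟙 (link G S ℓ x v)
      eq v with y Fin.≟ v
      ... | yes refl rewrite link-+ᵛ-∈ʳ S y x | h = refl
      ... | no y≢v = trans (+-identityʳ _)
        (cong 𝟙 (link-+ᵛ S x y v (y≢v ∘ sym) (adjacent-≢ G (proj₁ (link-elim {S} h)))))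

  module _ (base : ∀ S → links G S ℓ ≡ 0 → 2 * labels S ℓ + 3 * isos S ≤ card S + 2) where

    private
      weaken : ∀ S → Bound S 2 → Bound S 0
      weaken S = ≤-trans (+-monoʳ-≤ (4 * labels S ℓ + 6 * isos S) z≤n)

      -- Deleting x costs 2 for |S| and, if x is a label class of its own, 4 for the label; it gains twice
      -- its number of links. If x and y have two links each, the loss from deleting y is regained by
      -- deleting the other neighbour z of x, which isolates x.
      bound-step : ∀ S → (∀ y → S y ≡ false → Bound (S +ᵛ y) 0) →
        (∀ y z → S y ≡ false → (S +ᵛ y) z ≡ false → Bound (S +ᵛ y +ᵛ z) 0) → ∀ x y → Link S x y → Bound S 0
      bound-step S rec rec₂ x y h = caseˣ (shared? S x) (3 ≤? linkDeg S x) (linkDeg S x ≤? 1)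
        where
        h′ : Link S y x
        h′ = trans (link-sym S y x) h
        Sx = proj₁ (proj₂ (link-elim {S} h))
        Sy = proj₁ (proj₂ (proj₂ (link-elim {S} h)))

        second : ¬ Shared S x → linkDeg S x ≤ 2 → 2 ≤ linkDeg S x → Bound (S +ᵛ y) 2
        second single ≤2 ≥2 =
          let eq    = linkDeg-+ᵛ S x y h
              z , p = sum-positive _ (≤-pred (≤-trans ≥2 (≤-reflexive (trans (sym eq) (+-comm _ 1)))))
              hz    = 𝟙-positive p
              Sz    = proj₁ (proj₂ (proj₂ (link-elim {S +ᵛ y} hz)))
          in pendant (S +ᵛ y) x z
               (λ (w , w≢x , Sw , eqw) → single (w , w≢x , proj₁ (+ᵛ-∉⁻ S Sw) , eqw))
               (≤-pred (≤-trans (≤-reflexive (trans (+-comm 1 _) eq)) ≤2)) hz (rec₂ y z Sy Sz)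

        caseʸ : ¬ Shared S x → linkDeg S x ≤ 2 → 2 ≤ linkDeg S x →
          Dec (Shared S y) → Dec (3 ≤ linkDeg S y) → Dec (linkDeg S y ≤ 1) → Bound S 0
        caseʸ _ _ _ (yes sh) _ _ =
          delete S y Sy (labels-shared S y sh) (isos-+ᵛ S y x h′) (*-monoʳ-≤ 2 (linkDeg-positive {S} h′)) (rec y Sy)
        caseʸ _ _ _ (no _) (yes ≥3) _ =
          delete S y Sy (labels-+ᵛ S y) (isos-+ᵛ S y x h′) (*-monoʳ-≤ 2 ≥3) (rec y Sy)
        caseʸ _ _ _ (no single) (no _) (yes ≤1) = weaken S (pendant S y x single ≤1 h′ (rec x Sx))
        caseʸ single ≤2 ≥2 (no _) (no _) (no ≰1) =
          delete S y Sy (labels-+ᵛ S y) (isos-+ᵛ S y x h′) (+-monoʳ-≤ 2 (*-monoʳ-≤ 2 (≰⇒> ≰1))) (second single ≤2 ≥2)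

        caseˣ : Dec (Shared S x) → Dec (3 ≤ linkDeg S x) → Dec (linkDeg S x ≤ 1) → Bound S 0
        caseˣ (yes sh) _ _ =
          delete S x Sx (labels-shared S x sh) (isos-+ᵛ S x y h) (*-monoʳ-≤ 2 (linkDeg-positive {S} h)) (rec x Sx)
        caseˣ (no _) (yes ≥3) _ =
          delete S x Sx (labels-+ᵛ S x) (isos-+ᵛ S x y h) (*-monoʳ-≤ 2 ≥3) (rec x Sx)
        caseˣ (no single) (no _) (yes ≤1) = weaken S (pendant S x y single ≤1 h (rec y Sy))
        caseˣ (no single) (no ≱3) (no ≰1) =
          caseʸ single (≤-pred (≰⇒> ≱3)) (≰⇒> ≰1) (shared? S y) (3 ≤? linkDeg S y) (linkDeg S y ≤? 1)

      bound-rec : ∀ S → Acc _<_ (card (not ∘ S)) → Bound S 0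
      bound-rec S (acc rs) with Fin.any? (λ x → Fin.any? (λ y → link G S ℓ x y Bool.≟ true))
      ... | yes (x , y , h) = bound-step S
        (λ y Sy → bound-rec (S +ᵛ y) (rs (card-not-+ᵛ S Sy)))
        (λ y z Sy Sz → bound-rec (S +ᵛ y +ᵛ z) (rs (<-trans (card-not-+ᵛ (S +ᵛ y) Sz) (card-not-+ᵛ S Sy))))
        x y h
      -- Without links the bound is twice the inequality `base`.
      ... | no none = cancel-≤ (*-monoʳ-≤ 2 (base S no-links))
        (≤-trans (≤-reflexive (eq (labels S ℓ) (isos S) (card S))) (+-monoˡ-≤ (2 * (2 * labels S ℓ + 3 * isos S)) (m≤m+n (2 * card S + 4) (links G S ℓ))))
        where
        no-links : links G S ℓ ≡ 0
        no-links = sum-zero (λ x → sum-zero (λ y → zero′ x y))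
          where
          zero′ : ∀ x y → 𝟙 (link G S ℓ x y) ≡ 0
          zero′ x y with link G S ℓ x y in eq
          ... | true  = contradiction (x , y , eq) none
          ... | false = refl
        eq : ∀ l o c → 4 * l + 6 * o + 0 + 2 * (c + 2) ≡ 2 * c + 4 + 2 * (2 * l + 3 * o)
        eq = solve-∀

    labels-bound : ∀ S → 4 * labels S ℓ + 6 * isos S ≤ 2 * card S + 4 + links G S ℓ
    labels-bound S = ≤-trans (m≤m+n _ 0) (bound-rec S (<-wellFounded _))

-- Growing a good edge list to 2n - 2 edges

module _ {n} (G : Multigraph n)
         (bound : ∀ ℓ S → 4 * labels S ℓ + 6 * isos G ℓ S ≤ 2 * card S + 4 + links G S ℓ) where

  good-[] : Good G []
  good-[] = record
    { sparse = λ X v Xv → *-monoʳ-≤ 2 (card-positive X Xv)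
    ; fits   = λ _ _ → z≤n
    ; deg≤5  = λ _ → z≤n }

  -- In a closed state `many-labels` forces 4p to exceed by 2 what `bound` allows for p labels.
  larger : ∀ {H} → Good G H → length H + 3 ≤ 2 * n → Larger G H
  larger {H} good short with larger-or-closed G good
  ... | inj₁ l = l
  ... | inj₂ (S , st , closed) = contradiction
    (≤-trans (many-labels G {H} {S} sp short (State.saturated st) {ℓ} labelling-tight closed′)
             (≤-trans (m≤m+n _ _) (bound ℓ S)))
    (<⇒≱ (strictly (card S) (links G S ℓ)))
    where
    sp = sparse good
    open Labelling {H = H} sp S
    closed′ : ∀ x y → S x ≡ false → S y ≡ false → 0 < mult G x y → 0 < m H x y ⊎ ℓ x ≡ ℓ y
    closed′ x y Sx Sy adj = [ inj₁ , (λ c → inj₂ (covered⇒≡ Sx Sy c)) ]′ (closed x y Sx Sy adj)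
    strictly : ∀ s l → 2 * s + 4 + l < l + 2 * s + 6
    strictly s l = ≤-trans (m≤m+n _ 1) (≤-reflexive (eq s l))
      where
      eq : ∀ s l → suc (2 * s + 4 + l) + 1 ≡ l + 2 * s + 6
      eq = solve-∀

  maximal : 0 < n → ∃[ H ] (Good G H × length H + 2 ≡ 2 * n)
  -- The fuel is the number of missing edges; `0<n` makes the truncated subtraction exact.
  maximal 0<n = grow (2 * n ∸ 2) [] good-[] (m+[n∸m]≡n (*-monoʳ-≤ 2 0<n))
    where
    grow : ∀ k H → Good G H → length H + 2 + k ≡ 2 * n → ∃[ H′ ] (Good G H′ × length H′ + 2 ≡ 2 * n)
    grow zero    H good eq = H , good , trans (sym (+-identityʳ _)) eq
    grow (suc k) H good eq
      = let H⁺ , good⁺ , len = larger good (≤-trans (≤-reflexive (+-suc (length H) 2)) (≤-trans (m≤m+n _ k) (≤-reflexive eq′)))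
        in grow k H⁺ good⁺ (trans (cong (λ l → l + 2 + k) len) eq′)
      where
      eq′ : suc (length H + 2) + k ≡ 2 * n
      eq′ = trans (sym (+-suc (length H + 2) k)) eq

-- Splitting a sparse graph with 2n - 2 edges into two connected spanning subgraphs

Joined : List (Edge n) → Fin n → Fin n → Set
Joined T u v = (u , v) ∈ T ⊎ (v , u) ∈ T

Connects : VSet n → List (Edge n) → Set
Connects X T = ∀ {u v} → X u ≡ true → X v ≡ true → Star (Joined T) u v

joined-mono : ∀ {T T′ : List (Edge n)} → (∀ {e} → e ∈ T → e ∈ T′) → ∀ {u v} → Joined T u v → Joined T′ u v
joined-mono f = [ inj₁ ∘ f , inj₂ ∘ f ]′

star-sym : ∀ {T : List (Edge n)} {u v} → Star (Joined T) u v → Star (Joined T) v u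
star-sym = Star.reverse [ inj₂ , inj₁ ]′

Ends : Fin n → Fin n → Edge n → Set
Ends v w e = e ≡ (v , w) ⊎ e ≡ (w , v)

ends-joined : ∀ {T : List (Edge n)} {v w e} → Ends v w e → e ∈ T → Joined T v w
ends-joined (inj₁ refl) e∈T = inj₁ e∈T
ends-joined (inj₂ refl) e∈T = inj₂ e∈T

module _ {X : VSet n} {v : Fin n} {T : List (Edge n)} where

  connects-via : ∀ {w} → (∀ {u} → (X -ᵛ v) u ≡ true → Star (Joined T) u w) → Star (Joined T) v w → Connects X T
  connects-via {w} f p Xu Xu′ = g Xu ◅◅ star-sym (g Xu′)
    where
    g : ∀ {u} → X u ≡ true → Star (Joined T) u w
    g {u} Xu with u Fin.≟ v
    ... | yes refl = p
    ... | no u≢v   = f (-ᵛ-intro X Xu u≢v)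

connects-attach : ∀ {X : VSet n} {v w T e} → Ends v w e → (X -ᵛ v) w ≡ true → Connects (X -ᵛ v) T → Connects X (e ∷ T)
connects-attach en Xw con =
  connects-via (λ Xu → Star.map (joined-mono there) (con Xu Xw)) (ends-joined en (here refl) ◅ ε)

-- The path through `v` takes over the role of the edge from `a` to `b`.
connects-subdivide : ∀ {X : VSet n} {v a b T e f} → Ends v a e → Ends v b f → (X -ᵛ v) a ≡ true →
  Connects (X -ᵛ v) ((a , b) ∷ T) → Connects X (e ∷ f ∷ T)
connects-subdivide {X = X} {v} {a} {b} {T} {e} {f} va vb Xa con =
  connects-via (λ Xu → (con Xu Xa) Star.>>= replace) (v–a ◅ ε)
  where
  _~_ = Joined (e ∷ f ∷ T)
  v–a : v ~ a
  v–a = ends-joined va (here refl)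
  v–b : v ~ b
  v–b = ends-joined vb (there (here refl))
  a⋯b : Star _~_ a b
  a⋯b = star-sym (v–a ◅ ε) ◅◅ (v–b ◅ ε)
  replace : ∀ {u w} → Joined ((a , b) ∷ T) u w → Star _~_ u w
  replace (inj₁ (here refl)) = a⋯b
  replace (inj₂ (here refl)) = star-sym a⋯b
  replace (inj₁ (there p))   = inj₁ (there (there p)) ◅ ε
  replace (inj₂ (there p))   = inj₂ (there (there p)) ◅ ε

connects-↭ : ∀ {X : VSet n} {T T′} → T ↭ T′ → Connects X T → Connects X T′
connects-↭ p con Xu Xv = Star.map (joined-mono (∈-resp-↭ p)) (con Xu Xv)

Within : VSet n → List (Edge n) → Set
Within X = All (λ e → inside X e ≡ true)

-- When `H` has 2|X| - 2 edges, all inside a nonempty `X`, connected parts are spanning trees, so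
-- connectedness is all that is recorded.
TwoTrees : VSet n → List (Edge n) → Set
TwoTrees X H = ∃₂ λ T₁ T₂ → H ↭ T₁ ++ T₂ × Connects X T₁ × Connects X T₂

sparse-↭ : {H J : List (Edge n)} → H ↭ J → Sparse H → Sparse J
sparse-↭ p sp X v Xv = subst (λ k → k + 2 ≤ 2 * card X) (tot-↭ _ p) (sp X v Xv)

sparse-++ʳ : ∀ D {A : List (Edge n)} → Sparse (D ++ A) → Sparse A
sparse-++ʳ D {A} sp X v Xv =
  ≤-trans (+-monoˡ-≤ 2 (≤-trans (m≤n+m _ (i D X)) (≤-reflexive (sym (tot-++ _ D A))))) (sp X v Xv)

tot-within : ∀ (X : VSet n) {H} → Within X H → ∀ {g h} → (∀ e → inside X e ≡ true → g e ≡ h e) → tot g H ≡ tot h H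
tot-within X []       eq = refl
tot-within X (p ∷ ps) eq = cong₂ _+_ (eq _ p) (tot-within X ps eq)

i-within : ∀ (X : VSet n) {H} → Within X H → i H X ≡ length H
i-within X {H} w = trans (tot-within X w (λ e h → cong 𝟙 h)) (tot-1 H)

filter-↭ : ∀ {A : Set} (p : A → Bool) H → H ↭ filterᵇ p H ++ filterᵇ (not ∘ p) H
filter-↭ p []      = Perm.refl
filter-↭ p (e ∷ H) with p e
... | true  = prep e (filter-↭ p H)
... | false = Perm.trans (prep e (filter-↭ p H)) (↭-sym (shift e (filterᵇ p H) _))

touches : Fin n → Edge n → Bool
touches v (a , b) = does (a Fin.≟ v) ∨ does (b Fin.≟ v)

-- The degrees add up to 4|X| - 4, so they cannot all be 4 or more.
low-degree : ∀ {H} (X : VSet n) → Within X H → length H + 2 ≡ 2 * card X → ∃[ v ] (X v ≡ true × d H v ≤ 3)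
low-degree {H = H} X within len with Fin.any? (λ v → (X v Bool.≟ true) ×-dec (d H v ≤? 3))
... | yes p = p
... | no none = contradiction
  (≤-trans (≤-reflexive (sym (sum-* 4 (𝟙 ∘ X)))) (≤-trans (sum-mono high) (≤-reflexive twice)))
  (<⇒≱ (≤-trans (m≤m+n _ 3) (≤-reflexive (trans (eq (length H)) (trans (cong (2 *_) len) (sym (*-assoc 2 2 (card X))))))))
  where
  eq : ∀ l → suc (2 * l) + 3 ≡ 2 * (l + 2)
  eq = solve-∀
  high : ∀ v → 4 * 𝟙 (X v) ≤ d H v * 𝟙 (X v)
  high v with X v in Xv
  ... | true  = *-monoˡ-≤ 1 (≰⇒> (λ le → none (v , Xv , le)))
  ... | false = z≤n
  twice : sum (λ v → d H v * 𝟙 (X v)) ≡ 2 * length H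
  twice = trans (sum-d H (𝟙 ∘ X))
    (trans (tot-within X within (λ (a , b) h → cong₂ (λ p q → 𝟙 p + 𝟙 q) (proj₁ (∧-true {X a} {X b} h)) (proj₂ (∧-true {X a} {X b} h))))
    (trans (sym (tot-*ˡ 2 (λ _ → 1) H)) (cong (2 *_) (tot-1 H))))

Spoke : VSet n → Fin n → Edge n → Set
Spoke X v e = ∃[ w ] ((X -ᵛ v) w ≡ true × Ends v w e)

spokes : ∀ (X : VSet n) {H} v → Sparse H → Within X H → All (Spoke X v) (filterᵇ (touches v) H)
spokes X {H = []}          v sp []       = []
spokes X {(a , b) ∷ H} v sp (p ∷ within) with a Fin.≟ v | b Fin.≟ v
... | no _     | no _     = spokes X {H} v (sparse-++ʳ ((a , b) ∷ []) {H} sp) within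
... | yes refl | no b≢v   = (b , -ᵛ-intro X (proj₂ (∧-true {X a} p)) b≢v , inj₁ refl)
                              ∷ spokes X {H} v (sparse-++ʳ ((a , b) ∷ []) {H} sp) within
... | no a≢v   | yes refl = (a , -ᵛ-intro X (proj₁ (∧-true {X a} p)) a≢v , inj₂ refl)
                              ∷ spokes X {H} v (sparse-++ʳ ((a , b) ∷ []) {H} sp) within
-- A loop would be an edge spanned by a singleton, which sparsity forbids.
... | yes refl | yes refl = contradiction (sp ｛ v ｝ᵛ v (∈｛｝ v)) (<⇒≱ loop)
  where
  loop : 2 * card ｛ v ｝ᵛ < 𝟙 (inside ｛ v ｝ᵛ (v , v)) + i H ｛ v ｝ᵛ + 2
  loop rewrite ∈｛｝ v | sum-δ₁ v = s≤s (m≤n+m 2 _)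

rest-within : ∀ (X : VSet n) {H} v → Within X H → Within (X -ᵛ v) (filterᵇ (not ∘ touches v) H)
rest-within X {H = []}          v []       = []
rest-within X {(a , b) ∷ H} v (p ∷ within) with a Fin.≟ v in eqa | b Fin.≟ v in eqb
... | yes _ | _     = rest-within X {H} v within
... | no _  | yes _ = rest-within X {H} v within
... | no a≢v | no b≢v =
  cong₂ _∧_ (-ᵛ-intro X (proj₁ (∧-true {X a} p)) a≢v) (-ᵛ-intro X (proj₂ (∧-true {X a} p)) b≢v)
    ∷ rest-within X {H} v within

length-spokes : ∀ (H : List (Edge n)) v → length (filterᵇ (touches v) H) ≤ d H v
length-spokes H v = ≤-trans (≤-reflexive (trans (sym (tot-1 (filterᵇ (touches v) H))) (tot-filter (λ _ → 1) (touches v) H)))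
  (tot-mono (λ (a , b) → truthTable 2 (λ x y → 𝟙 (x ∨ y) * 1) (λ x y → 𝟙 x + 𝟙 y) (does (a Fin.≟ v)) (does (b Fin.≟ v))) H)

-- The part that contains the auxiliary edge `ab` has it subdivided by `v` through `e` and `f`; the
-- third spoke `g` attaches `v` to the other part.
split-spoke : ∀ {X : VSet n} {v A e f g a b} → Ends v a e → Ends v b f → Spoke X v g →
  (X -ᵛ v) a ≡ true → TwoTrees (X -ᵛ v) ((a , b) ∷ A) → TwoTrees X (e ∷ f ∷ g ∷ A)
split-spoke {X = X} {v} {A} {e} {f} {g} {a} {b} va vb (c , Xc , vc) Xa (T₁ , T₂ , p , con₁ , con₂) =
  [ (λ ∈₁ → build T₁ T₂ p con₁ con₂ ∈₁) , (λ ∈₂ → build T₂ T₁ (Perm.trans p (++-comm T₁ T₂)) con₂ con₁ ∈₂) ]′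
    (∈-++⁻ T₁ (∈-resp-↭ p (here refl)))
  where
  build : ∀ T T′ → (a , b) ∷ A ↭ T ++ T′ → Connects (X -ᵛ v) T → Connects (X -ᵛ v) T′ → (a , b) ∈ T →
    TwoTrees X (e ∷ f ∷ g ∷ A)
  build T T′ p con con′ ab∈T with xs , ys , refl ← ∈-∃++ ab∈T =
    e ∷ f ∷ (xs ++ ys) , g ∷ T′
    , prep e (prep f (Perm.trans (prep g (drop-∷ (Perm.trans p (++⁺ʳ T′ (shift (a , b) xs ys))))) (↭-sym (shift g (xs ++ ys) T′))))
    , connects-subdivide va vb Xa (connects-↭ (shift (a , b) xs ys) con)
    , connects-attach vc Xc con′

i-mono : ∀ (H : List (Edge n)) {X Y} → X ⊆ᵛ Y → i H X ≤ i H Y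
i-mono H {X} {Y} X⊆Y = tot-mono (λ (a , b) → le (X a) (X b) (X⊆Y a) (X⊆Y b)) H
  where
  le : ∀ p q {r s} → (p ≡ true → r ≡ true) → (q ≡ true → s ≡ true) → 𝟙 (p ∧ q) ≤ 𝟙 (r ∧ s)
  le true  true  f g rewrite f refl | g refl = ≤-refl
  le true  false f g = z≤n
  le false q     f g = z≤n

-- Adding `v` to `Y` adds three edges but at most one vertex, which sparsity forbids if `Y` spans
-- 2|Y| - 2 edges already.
three-spokes : ∀ {A : List (Edge n)} {v a b c e f g Y} → Sparse (e ∷ f ∷ g ∷ A) →
  Ends v a e → Ends v b f → Ends v c g → Y a ≡ true → Y b ≡ true → Y c ≡ true → ¬ Tight A Y
three-spokes {A = A} {v} {e = e} {f} {g} {Y} sp va vb vc Ya Yb Yc tY = <-irrefl {2} refl (cancel-≤ {3} {2}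
  (+-mono-≤ (+-mono-≤ tY (i-mono A (λ u → ∪-introˡ Y ｛ v ｝ᵛ {u})))
            (≤-trans counted (*-monoʳ-≤ 2 (≤-trans (card-∪-≤ Y ｛ v ｝ᵛ) (≤-reflexive (cong (card Y +_) (sum-δ₁ v)))))))
  (≤-reflexive (eq (card Y) (i A Y) (i A Z))))
  where
  Z : VSet _
  Z = Y ∪ᵛ ｛ v ｝ᵛ
  eq : ∀ y k z → 3 + (k + 2 + z + 2 * (y + 1)) ≡ 2 + (2 * y + k + (3 + z + 2))
  eq = solve-∀
  Zv : Z v ≡ true
  Zv = ∪-introʳ Y ｛ v ｝ᵛ (∈｛｝ v)
  inside-Z : ∀ {w e} → Ends v w e → Y w ≡ true → inside Z e ≡ true
  inside-Z (inj₁ refl) Yw = cong₂ _∧_ Zv (∪-introˡ Y ｛ v ｝ᵛ Yw)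
  inside-Z (inj₂ refl) Yw = cong₂ _∧_ (∪-introˡ Y ｛ v ｝ᵛ Yw) Zv
  counted : 3 + i A Z + 2 ≤ 2 * card Z
  counted = subst (_≤ 2 * card Z)
    (cong (_+ 2) (cong₂ _+_ (cong 𝟙 (inside-Z va Ya)) (cong₂ _+_ (cong 𝟙 (inside-Z vb Yb))
      (cong (_+ i A Z) (cong 𝟙 (inside-Z vc Yc))))))
    (sp Z v Zv)

-- Induction on |X|, undoing a Henneberg step at a vertex `v` of degree at most 3. The edges `A`
-- away from `v`, with one edge added in the case of three spokes, satisfy the hypotheses on `X′`.
two-trees : ∀ k (X : VSet n) → card X ≡ suc k → ∀ H → Sparse H → Within X H → length H + 2 ≡ 2 * card X → TwoTrees X H
two-trees zero X one [] sp within len = [] , [] , Perm.refl , (λ {u} {v} → trivial {u} {v}) , (λ {u} {v} → trivial {u} {v})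
  where
  trivial : Connects X []
  trivial {u} {v} Xu Xv with v Fin.≟ u
  ... | yes refl = ε
  ... | no v≢u = contradiction
    (subst (λ c → card (X -ᵛ u) < c) (trans (sym (card-remove X Xu)) one) ≤-refl)
    (≤⇒≯ (card-positive (X -ᵛ u) (-ᵛ-intro X Xv v≢u)))
two-trees zero X one (e ∷ H) sp within len rewrite one = contradiction (+-cancelʳ-≡ 2 (suc (length H)) 0 len) λ ()
two-trees {n} (suc k) X big H sp within len with low-degree {H = H} X within len
... | v , Xv , d≤3 = connect (↭-sym (filter-↭ (touches v) H))
                             (length-spokes H v) (spokes X {H} v sp within) (rest-within X {H} v within)
  where
  X′ = X -ᵛ v

  card-X′ : card X′ ≡ suc k
  card-X′ = suc-injective (trans (sym (card-remove X Xv)) big)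

  transport : ∀ {H′} → H′ ↭ H → TwoTrees X H′ → TwoTrees X H
  transport p (T₁ , T₂ , q , con₁ , con₂) = T₁ , T₂ , Perm.trans (↭-sym p) q , con₁ , con₂

  connect : ∀ {D A} → D ++ A ↭ H → length D ≤ d H v → All (Spoke X v) D → Within X′ A → TwoTrees X H
  connect {D} {A} p short sps within′ = go D refl sps
    where
    spDA : Sparse (D ++ A)
    spDA = sparse-↭ (↭-sym p) sp

    spA : Sparse A
    spA = sparse-++ʳ D {A} spDA

    length-DA : length D + length A ≡ 2 * suc k
    length-DA = +-cancelʳ-≡ 2 _ _ (begin
      length D + length A + 2   ≡⟨ cong (_+ 2) (trans (sym (length-++ D)) (↭-length p)) ⟩
      length H + 2              ≡⟨ trans len (cong (2 *_) big) ⟩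
      2 * suc (suc k)           ≡⟨ eq k ⟩
      2 * suc k + 2             ∎)
      where
      open ≡-Reasoning
      eq : ∀ k → 2 * suc (suc k) ≡ 2 * suc k + 2
      eq = solve-∀

    length-A : length A + 2 ≤ 2 * suc k
    length-A =
      let w , pos = sum-positive (𝟙 ∘ X′) (≤-trans (s≤s z≤n) (≤-reflexive (sym card-X′)))
      in subst₂ (λ l c → l + 2 ≤ 2 * c) (i-within X′ within′) card-X′ (spA X′ w (𝟙-positive pos))

    recurse : ∀ {a b} → length A + 3 ≡ 2 * suc k → Sparse ((a , b) ∷ A) → X′ a ≡ true → X′ b ≡ true →
      TwoTrees X′ ((a , b) ∷ A)
    recurse len′ sp′ Xa Xb = two-trees k X′ card-X′ _ sp′ (cong₂ _∧_ Xa Xb ∷ within′)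
      (trans (sym (+-suc (length A) 2)) (trans len′ (cong (2 *_) (sym card-X′))))

    go : ∀ D′ → D ≡ D′ → All (Spoke X v) D′ → TwoTrees X H
    -- With no spoke or only one, `A` would have more than 2|X′| - 2 edges.
    go [] refl _ = contradiction (≤-trans length-A (≤-reflexive (sym length-DA))) (<⇒≱ (m<m+n (length A) z<s))
    go (_ ∷ []) refl _ = contradiction (≤-trans length-A (≤-reflexive (sym length-DA)))
      (<⇒≱ (≤-reflexive (+-comm 2 (length A))))
    go (_ ∷ _ ∷ _ ∷ _ ∷ _) refl _ = contradiction (≤-trans short d≤3) λ { (s≤s (s≤s (s≤s ()))) }
    -- Two spokes: each part receives one of them.
    go (e ∷ f ∷ []) refl ((a , Xa , va) ∷ (b , Xb , vb) ∷ []) =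
      let T₁ , T₂ , q , con₁ , con₂ = two-trees k X′ card-X′ A spA within′
            (trans (+-comm (length A) 2) (trans length-DA (cong (2 *_) (sym card-X′))))
      in transport p
        ( e ∷ T₁ , f ∷ T₂ , prep e (Perm.trans (prep f q) (↭-sym (shift f T₁ T₂)))
        , connects-attach va Xa con₁ , connects-attach vb Xb con₂ )
    go (e ∷ f ∷ g ∷ []) refl ((a , Xa , va) ∷ (b , Xb , vb) ∷ (c , Xc , vc) ∷ [])
      with sparse-or-tight {H = A} spA a b | sparse-or-tight {H = A} spA b c
    ... | inj₁ spab | _ = transport p (split-spoke va vb (c , Xc , vc) Xa
      (recurse (trans (+-comm (length A) 3) length-DA) spab Xa Xb))
    ... | inj₂ _ | inj₁ spbc = transport (Perm.trans (shift e (f ∷ g ∷ []) A) p)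
      (split-spoke vb vc (a , Xa , va) Xb (recurse (trans (+-comm (length A) 3) length-DA) spbc Xb Xc))
    -- If neither `ab` nor `bc` can be added, the two obstructing tight sets share `b`, and their
    -- union is a tight set containing all three neighbours of `v`.
    ... | inj₂ (Y₁ , Y₁a , Y₁b , t₁) | inj₂ (Y₂ , Y₂b , Y₂c , t₂) = ⊥-elim (three-spokes {A = A} spDA va vb vc
      (∪-introˡ Y₁ Y₂ Y₁a) (∪-introˡ Y₁ Y₂ Y₁b) (∪-introʳ Y₁ Y₂ Y₂c) (tight-∪ {H = A} spA t₁ t₂ Y₁b Y₂b))

-- Components and isolated vertices after vertex deletion

∣∣≡card : ∀ {n} (P : Subset n) → ∣ P ∣ ≡ card (lookup P)
∣∣≡card []          = refl
∣∣≡card (true ∷ P)  = cong suc (∣∣≡card P)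
∣∣≡card (false ∷ P) = ∣∣≡card P

sum-embed : ∀ {n} (P : Subset n) (g : Fin n → ℕ) → sum (λ v → 𝟙 (lookup P v) * g v) ≡ sum (λ i → g (embed P i))
sum-embed []          g = refl
sum-embed (true ∷ P)  g = cong₂ _+_ (+-identityʳ (g zero)) (sum-embed P (g ∘ suc))
sum-embed (false ∷ P) g = sum-embed P (g ∘ suc)

embed-∈ : ∀ {n} (P : Subset n) i → lookup P (embed P i) ≡ true
embed-∈ (true ∷ P)  zero    = refl
embed-∈ (true ∷ P)  (suc i) = embed-∈ P i
embed-∈ (false ∷ P) i       = embed-∈ P i

embed-surjective : ∀ {n} (P : Subset n) v → lookup P v ≡ true → ∃[ i ] embed P i ≡ v
embed-surjective (true ∷ P)  zero    h = zero , refl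
embed-surjective (true ∷ P)  (suc v) h with i , eq ← embed-surjective P v h = suc i , cong suc eq
embed-surjective (false ∷ P) (suc v) h with i , eq ← embed-surjective P v h = i , cong suc eq

length-filter-tabulate : ∀ {A : Set} {P : A → Set} (P? : ∀ x → Dec (P x)) {k} (f : Fin k → A) →
  length (filter P? (List.tabulate f)) ≡ sum (λ i → 𝟙 (does (P? (f i))))
length-filter-tabulate P? {zero}  f = refl
length-filter-tabulate P? {suc k} f with does (P? (f zero))
... | true  = cong suc (length-filter-tabulate P? (f ∘ suc))
... | false = length-filter-tabulate P? (f ∘ suc)

tot-any : ∀ {A : Set} {n} (f : A → Fin n) c {L} → Any (λ r → f r ≡ c) L → 1 ≤ tot (λ r → δ (f r) c) L
tot-any f c (here refl) = ≤-trans (≤-reflexive (sym (δ-refl (f _)))) (m≤m+n _ _)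
tot-any f c (there p)   = ≤-trans (tot-any f c p) (m≤n+m _ _)

module _ {n} (G : Multigraph n) (ℓ : Fin n → Fin n) (S : VSet n) where

  private
    P = tabulate S
    G′ = G ∖ P

    ∁P : ∀ v → lookup (∁ P) v ≡ not (S v)
    ∁P v = trans (lookup-map v not P) (cong not (lookup∘tabulate S v))

    embed-∉ : ∀ j → S (embed (∁ P) j) ≡ false
    embed-∉ j = not-true (trans (sym (∁P _)) (embed-∈ (∁ P) j))

  isos≤iso : isos G ℓ S ≤ iso G′
  isos≤iso = begin
    isos G ℓ S                                                         ≤⟨ sum-mono outside ⟩
    sum (λ v → 𝟙 (lookup (∁ P) v) * 𝟙 (does (isolated? G ℓ S v)))       ≡⟨ sum-embed (∁ P) _ ⟩
    sum (λ j → 𝟙 (does (isolated? G ℓ S (embed (∁ P) j))))              ≤⟨ sum-mono isolated ⟩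
    sum (λ j → 𝟙 (does (deg G′ j ≟ 0)))                                ≡⟨ length-filter-tabulate (λ v → deg G′ v ≟ 0) id ⟨
    iso G′                                                             ∎
    where
    open ≤-Reasoning
    outside : ∀ v → 𝟙 (does (isolated? G ℓ S v)) ≤ 𝟙 (lookup (∁ P) v) * 𝟙 (does (isolated? G ℓ S v))
    outside v rewrite ∁P v with S v
    ... | true  = z≤n
    ... | false = ≤-reflexive (sym (+-identityʳ _))
    isolated : ∀ j → 𝟙 (does (isolated? G ℓ S (embed (∁ P) j))) ≤ 𝟙 (does (deg G′ j ≟ 0))
    isolated j = 𝟙-does-mono (isolated? G ℓ S (embed (∁ P) j)) (deg G′ j ≟ 0)
      (λ (_ , nb) → sum-zero (λ k → n≤0⇒n≡0 (≮⇒≥ (λ adj → true≢false (nb _ adj) (embed-∉ k)))))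

  -- Without links the label is constant on each component, so every label in use appears at one of
  -- the representatives counted by `ω`.
  labels≤ω : links G S ℓ ≡ 0 → labels S ℓ ≤ ω G′
  labels≤ω no-links = begin
    labels S ℓ                                            ≤⟨ sum-mono used ⟩
    sum (λ c → tot (λ r → δ (ℓ (embed (∁ P) r)) c) L)      ≡⟨ sum-tot (λ c r → δ (ℓ (embed (∁ P) r)) c) L ⟩
    tot (λ r → sum (δ (ℓ (embed (∁ P) r)))) L              ≡⟨ tot-cong (λ r → sum-δ₁ (ℓ (embed (∁ P) r))) L ⟩
    tot (λ _ → 1) L                                       ≡⟨ tot-1 L ⟩
    length L                                              ∎
    where
    open ≤-Reasoning
    L = deduplicate (reachable? G′) (allFin ∣ ∁ P ∣)

    no-link : ∀ u v → link G S ℓ u v ≡ false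
    no-link u v with link G S ℓ u v in eq
    ... | false = refl
    ... | true  = contradiction (≤-trans (≤-trans (≤-reflexive (cong 𝟙 (sym eq))) (sum-≥ (λ v → 𝟙 (link G S ℓ u v)) v))
                                         (≤-trans (sum-≥ (λ u → sum (λ v → 𝟙 (link G S ℓ u v))) u) (≤-reflexive no-links)))
                                λ ()

    same : ∀ {x y} → Reachable G′ x y → ℓ (embed (∁ P) x) ≡ ℓ (embed (∁ P) y)
    same ε = refl
    same {x} (_◅_ {j = z} adj p) = trans step (same p)
      where
      step : ℓ (embed (∁ P) x) ≡ ℓ (embed (∁ P) z)
      step with ℓ (embed (∁ P) x) Fin.≟ ℓ (embed (∁ P) z) in eq
      ... | yes q = q
      ... | no _  = ⊥-elim (true≢false
        (cong₂ _∧_ (dec-true (0 <? mult G _ _) adj)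
          (cong₂ _∧_ (cong not (embed-∉ x)) (cong₂ _∧_ (cong not (embed-∉ z)) (cong (not ∘ does) eq))))
        (no-link (embed (∁ P) x) (embed (∁ P) z)))

    used : ∀ c → 1 ⊓ card (cls S ℓ c) ≤ tot (λ r → δ (ℓ (embed (∁ P) r)) c) L
    used c with Fin.any? (λ v → cls S ℓ c v Bool.≟ true)
    ... | no none = ≤-trans (m⊓n≤n 1 _) (≤-trans (≤-reflexive (card-empty (cls S ℓ c) none)) z≤n)
    ... | yes (v , h)
      with Sv , lab ← ∧-true {not (S v)} {does (ℓ v Fin.≟ c)} h
      with j , refl ← embed-surjective (∁ P) v (trans (∁P v) Sv) =
      ≤-trans (m⊓n≤m 1 _) (tot-any (ℓ ∘ embed (∁ P)) c
        (Any.deduplicate⁺ (reachable? G′) (λ r eq → trans (same r) eq)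
          (Any.map (λ { refl → does-true (ℓ v Fin.≟ c) lab }) (∈-allFin j))))

-- Clearing denominators

open import Data.Integer.Base using (+_)

module _ (a b c : ℕ) (h : (+ 3 ℚ./ 2) ℚ.* fromℕ a ℚ.+ fromℕ b ℚ.≤ ½ ℚ.* fromℕ c ℚ.+ 1ℚ) where

  private
    open ℚᵘ.≤-Reasoning

    fromℕ-ᵘ : ∀ k → ℚ.toℚᵘ (fromℕ k) ℚᵘ.≃ (+ k ℚᵘ./ 1)
    fromℕ-ᵘ k = ℚ.toℚᵘ-fromℚᵘ (+ k ℚᵘ./ 1)

    unnormalised : (+ 3 ℚᵘ./ 2) ℚᵘ.* (+ a ℚᵘ./ 1) ℚᵘ.+ (+ b ℚᵘ./ 1) ℚᵘ.≤ (+ 1 ℚᵘ./ 2) ℚᵘ.* (+ c ℚᵘ./ 1) ℚᵘ.+ ℚᵘ.1ℚᵘ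
    unnormalised = begin
      (+ 3 ℚᵘ./ 2) ℚᵘ.* (+ a ℚᵘ./ 1) ℚᵘ.+ (+ b ℚᵘ./ 1)
        ≃⟨ ℚᵘ.+-cong (ℚᵘ.*-cong (ℚᵘ.≃-refl {+ 3 ℚᵘ./ 2}) (fromℕ-ᵘ a)) (fromℕ-ᵘ b) ⟨
      ℚ.toℚᵘ (+ 3 ℚ./ 2) ℚᵘ.* ℚ.toℚᵘ (fromℕ a) ℚᵘ.+ ℚ.toℚᵘ (fromℕ b)
        ≃⟨ ℚᵘ.+-cong (ℚ.toℚᵘ-homo-* (+ 3 ℚ./ 2) (fromℕ a)) (ℚᵘ.≃-refl {ℚ.toℚᵘ (fromℕ b)}) ⟨
      ℚ.toℚᵘ ((+ 3 ℚ./ 2) ℚ.* fromℕ a) ℚᵘ.+ ℚ.toℚᵘ (fromℕ b)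
        ≃⟨ ℚ.toℚᵘ-homo-+ ((+ 3 ℚ./ 2) ℚ.* fromℕ a) (fromℕ b) ⟨
      ℚ.toℚᵘ ((+ 3 ℚ./ 2) ℚ.* fromℕ a ℚ.+ fromℕ b)
        ≤⟨ ℚ.toℚᵘ-mono-≤ h ⟩
      ℚ.toℚᵘ (½ ℚ.* fromℕ c ℚ.+ 1ℚ)
        ≃⟨ ℚ.toℚᵘ-homo-+ (½ ℚ.* fromℕ c) 1ℚ ⟩
      ℚ.toℚᵘ (½ ℚ.* fromℕ c) ℚᵘ.+ ℚᵘ.1ℚᵘ
        ≃⟨ ℚᵘ.+-cong (ℚ.toℚᵘ-homo-* ½ (fromℕ c)) (ℚᵘ.≃-refl {ℚᵘ.1ℚᵘ}) ⟩
      ℚ.toℚᵘ ½ ℚᵘ.* ℚ.toℚᵘ (fromℕ c) ℚᵘ.+ ℚᵘ.1ℚᵘ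
        ≃⟨ ℚᵘ.+-cong (ℚᵘ.*-cong (ℚᵘ.≃-refl {+ 1 ℚᵘ./ 2}) (fromℕ-ᵘ c)) (ℚᵘ.≃-refl {ℚᵘ.1ℚᵘ}) ⟩
      (+ 1 ℚᵘ./ 2) ℚᵘ.* (+ c ℚᵘ./ 1) ℚᵘ.+ ℚᵘ.1ℚᵘ ∎

  clear-denominators : 2 * b + 3 * a ≤ c + 2
  clear-denominators with ℚᵘ.*≤* le ← unnormalised =
    -- Both sides have denominator 2, and cross-multiplication leaves a common factor 2.
    *-cancelʳ-≤ _ _ 2 (subst₂ _≤_ (eq₁ a b) (eq₂ c) (ℤ.drop‿+≤+ (subst₂ ℤ._≤_ lhs rhs le)))
    where
    lhs : ((+ 3 ℤ.* + a) ℤ.* + 1 ℤ.+ + b ℤ.* + 2) ℤ.* + 2 ≡ + ((3 * a * 1 + b * 2) * 2)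
    lhs = trans (cong (ℤ._* + 2) (trans (cong₂ ℤ._+_ (trans (cong (ℤ._* + 1) (sym (ℤ.pos-* 3 a))) (sym (ℤ.pos-* (3 * a) 1)))
                                                    (sym (ℤ.pos-* b 2)))
                                       (sym (ℤ.pos-+ (3 * a * 1) (b * 2)))))
                (sym (ℤ.pos-* (3 * a * 1 + b * 2) 2))
    rhs : ((+ 1 ℤ.* + c) ℤ.* + 1 ℤ.+ + 2) ℤ.* + 2 ≡ + ((1 * c * 1 + 2) * 2)
    rhs = trans (cong (ℤ._* + 2) (trans (cong (ℤ._+ + 2) (trans (cong (ℤ._* + 1) (sym (ℤ.pos-* 1 c))) (sym (ℤ.pos-* (1 * c) 1))))
                                       (sym (ℤ.pos-+ (1 * c * 1) 2))))
                (sym (ℤ.pos-* (1 * c * 1 + 2) 2))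
    eq₁ : ∀ a b → (3 * a * 1 + b * 2) * 2 ≡ (2 * b + 3 * a) * 2
    eq₁ = solve-∀
    eq₂ : ∀ c → (1 * c * 1 + 2) * 2 ≡ (c + 2) * 2
    eq₂ = solve-∀

-- The hypothesis as a bound for labellings

module _ {n} (G : Multigraph n)
         (tough : ∀ (S : Subset n) →
           (+ 3 ℚ./ 2) ℚ.* fromℕ (iso (G ∖ S)) ℚ.+ fromℕ (ω (G ∖ S)) ℚ.≤ ½ ℚ.* fromℕ ∣ S ∣ ℚ.+ 1ℚ) where

  tough⇒labels : ∀ ℓ S → links G S ℓ ≡ 0 → 2 * labels S ℓ + 3 * isos G ℓ S ≤ card S + 2
  tough⇒labels ℓ S no-links =
    ≤-trans (+-mono-≤ (*-monoʳ-≤ 2 (labels≤ω G ℓ S no-links)) (*-monoʳ-≤ 3 (isos≤iso G ℓ S)))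
   (≤-trans (clear-denominators (iso (G ∖ tabulate S)) (ω (G ∖ tabulate S)) ∣ tabulate S ∣ (tough (tabulate S)))
            (≤-reflexive (cong (_+ 2) (trans (∣∣≡card (tabulate S)) (card-≗ (lookup∘tabulate S))))))

  tough⇒labels-bound : ∀ ℓ S → 4 * labels S ℓ + 6 * isos G ℓ S ≤ 2 * card S + 4 + links G S ℓ
  tough⇒labels-bound ℓ = labels-bound G ℓ (tough⇒labels ℓ)

-- Joins

Even : ℕ → Set
Even k = parity k ≡ 0ℙ

parity-double : ∀ k l → parity (k + k + l) ≡ parity l
parity-double zero    l = refl
parity-double (suc k) l rewrite +-suc k k = parity-double k l

-- `J` is a join in `T` for the set of vertices at which `r` is odd; `J′` is the rest of `T`.
Join : List (Edge n) → (Fin n → ℕ) → Set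
Join T r = ∃₂ λ J J′ → T ↭ J ++ J′ × ∀ w → Even (d J w + r w)

join-cong : ∀ {T : List (Edge n)} {r s} → (∀ w → parity (r w) ≡ parity (s w)) → Join T r → Join T s
join-cong {r = r} {s} eq (J , J′ , p , even) = J , J′ , p , λ w → begin
  parity (d J w + s w)                ≡⟨ ℙ.+-homo-+ (d J w) (s w) ⟩
  parity (d J w) ℙ.+ parity (s w)     ≡⟨ cong (parity (d J w) ℙ.+_) (eq w) ⟨
  parity (d J w) ℙ.+ parity (r w)     ≡⟨ ℙ.+-homo-+ (d J w) (r w) ⟨
  parity (d J w + r w)                ≡⟨ even w ⟩
  0ℙ                                  ∎
  where open ≡-Reasoning

-- Symmetric difference with one edge: `e` moves from `J` to `J′` or back, which flips the parity at
-- both ends.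
toggle : ∀ {T : List (Edge n)} {r e} → e ∈ T → Join T r → Join T (λ w → r w + inc w e)
toggle {T = T} {r} {e} e∈T (J , J′ , p , even) = [ drop , add ]′ (∈-++⁻ J (∈-resp-↭ p e∈T))
  where
  drop : e ∈ J → Join T (λ w → r w + inc w e)
  drop e∈J with xs , ys , refl ← ∈-∃++ e∈J =
    xs ++ ys , e ∷ J′
    , Perm.trans p (Perm.trans (++⁺ʳ J′ (shift e xs ys)) (↭-sym (shift e (xs ++ ys) J′)))
    , λ w → trans (cong parity (trans (eq (d (xs ++ ys) w) (r w) (inc w e))
                    (cong (_+ r w) (sym (tot-↭ (inc w) (shift e xs ys)))))) (even w)
    where
    eq : ∀ x r k → x + (r + k) ≡ k + x + r
    eq = solve-∀
  add : e ∈ J′ → Join T (λ w → r w + inc w e)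
  add e∈J′ with xs , ys , refl ← ∈-∃++ e∈J′ =
    e ∷ J , xs ++ ys
    , Perm.trans p (Perm.trans (++⁺ˡ J (shift e xs ys)) (shift e J (xs ++ ys)))
    , λ w → trans (cong parity (eq (inc w e) (d J w) (r w))) (trans (parity-double (inc w e) _) (even w))
    where
    eq : ∀ k x r → k + x + (r + k) ≡ k + k + (x + r)
    eq = solve-∀

-- Toggling all edges of a path flips inner vertices twice, so only the parities at the two ends
-- change.
join-path : ∀ {T : List (Edge n)} {r a b} → Star (Joined T) a b → Join T r → Join T (λ w → r w + inc w (a , b))
join-path {r = r} {a} ε J = join-cong (λ w → sym (trans (cong parity (+-comm (r w) (δ a w + δ a w))) (parity-double (δ a w) (r w)))) J
join-path {T = T} {r} {a} {b} (_◅_ {j = z} a–z p) J =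
  join-cong (λ w → trans (cong parity (eq (r w) (δ a w) (δ z w) (δ b w))) (parity-double (δ z w) _))
            (join-path p (first-edge a–z))
  where
  eq : ∀ r a z b → r + (a + z) + (z + b) ≡ z + z + (r + (a + b))
  eq = solve-∀
  first-edge : Joined T a z → Join T (λ w → r w + (δ a w + δ z w))
  first-edge (inj₁ e∈T) = toggle e∈T J
  first-edge (inj₂ e∈T) = join-cong (λ w → cong (λ k → parity (r w + k)) (+-comm (δ z w) (δ a w))) (toggle e∈T J)

-- For each edge of `P` a path in `T` between its ends is added modulo 2.
joins : ∀ {T : List (Edge n)} → Connects (λ _ → true) T → ∀ P → Join T (d P)
joins {T = T} con []      = [] , T , Perm.refl , λ _ → refl
joins con ((a , b) ∷ P) =
  join-cong (λ w → cong parity (+-comm (d P w) (inc w (a , b)))) (join-path {a = a} {b} (con refl refl) (joins con P))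

-- Even spanning subgraphs from edge lists

module _ (G : Multigraph n) (F : List (Edge n)) (fits : Fits G F) where

  fromEdges : Multigraph n
  fromEdges = record
    { mult     = m F
    ; mult-sym = m-sym F
    ; loopless = λ v → n≤0⇒n≡0 (≤-trans (fits v v) (≤-reflexive (loopless G v))) }

  deg-fromEdges : ∀ v → deg fromEdges v ≡ d F v
  deg-fromEdges v = trans (sum-tot (λ u → at v u) F) (tot-cong (λ (a , b) → inner a b) F)
    where
    inner : ∀ a b → sum (λ u → δ a v * δ b u + δ a u * δ b v) ≡ δ a v + δ b v
    inner a b = trans (∑-distrib-+ (λ u → δ a v * δ b u) (λ u → δ a u * δ b v))
      (cong₂ _+_ (trans (sum-* (δ a v) (δ b)) (trans (cong (δ a v *_) (sum-δ₁ b)) (*-identityʳ (δ a v))))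
                 (sum-δ a (λ _ → δ b v)))

  joined⇒adj : ∀ {u v} → Joined F u v → Adj fromEdges u v
  joined⇒adj {u} {v} (inj₁ e∈F) = positive e∈F
    where
    positive : ∀ {H : List (Edge n)} {u v} → (u , v) ∈ H → 0 < m H u v
    positive {u = u} {v} (here refl) rewrite δ-refl u | δ-refl v = z<s
    positive {(a , b) ∷ H} {u} {v} (there p) = ≤-trans (positive p) (m≤n+m _ (at u v (a , b)))
  joined⇒adj {u} {v} (inj₂ e∈F) = subst (0 <_) (m-sym F v u) (joined⇒adj (inj₁ e∈F))

even≤5 : ∀ k → Even k → 0 < k → k ≤ 5 → k ≡ 2 ⊎ k ≡ 4
even≤5 2 _ _ _ = inj₁ refl
even≤5 4 _ _ _ = inj₂ refl
even≤5 (suc (suc (suc (suc (suc (suc k)))))) _ _ (s≤s (s≤s (s≤s (s≤s (s≤s ())))))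

-- The connected factor with even degrees

module _ (G : Multigraph n) (two : ∀ (v : Fin n) → ∃[ u ] u ≢ v) {H : List (Edge n)} (good : Good G H) where

  -- A join `J` in `T₂` with the degree parities of `T₁` makes T₁ ++ J even. This list is connected
  -- through `T₁`, and as part of `H` it keeps degrees of at most 5.
  eulerian : ∀ {T₁ T₂} → H ↭ T₁ ++ T₂ → Connects (λ _ → true) T₁ → Connects (λ _ → true) T₂ →
    ∃[ K ] (IsFactor (｛ + 2 ｝ ∪ ｛ + 4 ｝) G K × Connected K)
  eulerian {T₁} {T₂} p con₁ con₂ with joins con₂ T₁
  ... | J , J′ , q , even = K , (fits-F , λ v → degree v) , connected
    where
    F = T₁ ++ J

    below : ∀ g → tot g F ≤ tot g H
    below g = ≤-trans (m≤m+n _ (tot g J′)) (≤-reflexive (sym (trans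
      (tot-↭ g (Perm.trans p (Perm.trans (++⁺ˡ T₁ q) (↭-sym (++-assoc T₁ J J′))))) (tot-++ g F J′))))

    fits-F : Fits G F
    fits-F u v = ≤-trans (below (at u v)) (fits good u v)

    K = fromEdges G F fits-F

    connected : Connected K
    connected u v = Star.map (joined⇒adj G F fits-F ∘ joined-mono ∈-++⁺ˡ) (con₁ {u} {v} refl refl)

    -- Connectedness to a second vertex excludes 0, the remaining even degree below 6.
    positive : ∀ v → 0 < deg K v
    positive v = leaves (proj₂ (two v)) (connected v (proj₁ (two v)))
      where
      leaves : ∀ {u} → u ≢ v → Reachable K v u → 0 < deg K v
      leaves u≢v ε                   = contradiction refl u≢v
      leaves u≢v (_◅_ {j = z} adj _) = ≤-trans adj (sum-≥ (mult K v) z)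

    degree : ∀ v → (｛ + 2 ｝ ∪ ｛ + 4 ｝) (+ deg K v)
    degree v with even≤5 (deg K v) (subst Even (sym (trans (deg-fromEdges G F fits-F v)
                    (trans (tot-++ (inc v) T₁ J) (+-comm (d T₁ v) (d J v))))) (even v)) (positive v)
                    (≤-trans (≤-reflexive (deg-fromEdges G F fits-F v)) (≤-trans (below (inc v)) (deg≤5 good v)))
    ... | inj₁ eq = inj₁ (cong +_ (sym eq))
    ... | inj₂ eq = inj₂ (cong +_ (sym eq))

two-vertices : ∀ {k} (v : Fin (suc (suc k))) → ∃[ u ] u ≢ v
two-vertices zero    = suc zero , λ ()
two-vertices (suc v) = zero , λ ()

-- With `S` empty, the vertex is one label and one isolated vertex, so the left side is 10 and the
-- right side 4.
one-vertex : ∀ (G : Multigraph 1) → let S = λ _ → false in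
  ¬ (4 * labels S id + 6 * isos G id S ≤ 2 * card S + 4 + links G S id)
one-vertex G h = contradiction (subst₂ (λ o l → 4 + 6 * o ≤ 4 + l) isos≡1 links≡0 h) λ { (s≤s (s≤s (s≤s (s≤s ())))) }
  where
  S : VSet 1
  S _ = false
  isos≡1 : isos G id S ≡ 1
  isos≡1 = cong (λ b → 𝟙 b + 0) (dec-true (isolated? G id S zero)
    (refl , λ { zero adj → contradiction (subst (0 <_) (loopless G zero) adj) λ () }))
  links≡0 : links G S id ≡ 0
  links≡0 = cong (λ b → 𝟙 (does (0 <? b) ∧ false) + 0 + 0) (loopless G zero)

mainTheorem18 : ∀ {n : ℕ} (G : Multigraph n) →
    (∀ (S : Subset n) →
    (+ 3 ℚ./ 2) ℚ.* fromℕ (iso (G ∖ S)) ℚ.+ fromℕ (ω (G ∖ S)) ℚ.≤ ½ ℚ.* fromℕ ∣ S ∣ ℚ.+ 1ℚ) →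
    ∃[ H ] (IsFactor (｛ + 2 ｝ ∪ ｛ + 4 ｝) G H × Connected H)
-- The empty graph is its own factor.
mainTheorem18 {zero} G tough = G , ((λ _ _ → ≤-refl) , λ ()) , λ ()
mainTheorem18 {suc zero} G tough = contradiction (tough⇒labels-bound G tough id (λ _ → false)) (one-vertex G)
mainTheorem18 {n@(suc (suc k))} G tough =
  let H , good , len            = maximal G (tough⇒labels-bound G tough) z<s
      T₁ , T₂ , p , con₁ , con₂ = two-trees (suc k) (λ _ → true) (sum-1 n) H (sparse good)
                                    (All.universal (λ _ → refl) H) (trans len (cong (2 *_) (sym (sum-1 n))))
  in eulerian G two-vertices good p con₁ con₂
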